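{- Let $r\ge1$, let $P_r=\Phi^+(B_r)$ be the positive-root poset of type $B_r$ graded by $\operatorname{rk}(\alpha)=\operatorname{ht}(\alpha)-1$, and put $n=r-1$. For $0\le k\le n$, $$[t^k]\,\mathbb{H}_{P_r,\operatorname{rk}}(q,t)\in q^{k(k-1)}\,\mathbb{N}[q],\qquad \deg_q\,[t^k]\,\mathbb{H}_{P_r,\operatorname{rk}}(q,t)=k(2n-k-1).$$ Moreover, the coefficient of the highest power $q^{k(2n-k-1)}$ in $[t^k]\,\mathbb{H}_{P_r,\operatorname{rk}}(q,t)$ is equal to $1$.
   Context: $\mathbb N=\{0,1,2,\dots\}$. $q$-Zeta numerator: let $P$ be a finite graded poset with a unique maximum and rank function $\rho:P\to\{0,\dots,H\}$, where $H$ is the maximal rank. For $m\ge 0$ put $A_m(P,\rho;q)=\sum_{x_1\le\cdots\le x_m}q^{\rho(x_1)+\cdots+\rho(x_m)}$ (sum over weak chains in $P$; $A_0=1$). The numerator $\mathbb{H}_{P,\rho}(q,t)$ is the polynomial determined by $\sum_{m\ge 0}A_m(P,\rho;q)t^m=\mathbb{H}_{P,\rho}(q,t)/\prod_{a=0}^{H}(1-q^at)$. Type $B_r$ in $\mathbb{R}^r$ with standard basis $e_1,\dots,e_r$: simple roots $\alpha_i=e_i-e_{i+1}$ ($1\le i<r$), $\alpha_r=e_r$; positive roots $e_i-e_j$ ($i<j$), $e_i$, $e_i+e_j$ ($i<j$). Order: $\alpha\le\beta$ iff $\beta-\alpha$ is a nonnegative integer combination of simple roots. The height $\operatorname{ht}(\alpha)$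 is the sum of the simple-root coefficients of $\alpha$. -}

module Defs where

open import Data.Nat as ℕ using (ℕ; zero; suc)
open import Data.Integer as ℤ using (ℤ; +_; 0ℤ; 1ℤ)
import Data.Integer.Properties as ℤ
open import Data.Fin as Fin using (Fin; zero; suc; toℕ; fromℕ<)
open import Data.List as List using (List; []; _∷_; _++_)
open import Data.List.Extrema.Nat using (max)
open import Data.List.Relation.Unary.Linked using (Linked; linked?)
open import Data.Vec as Vec using (Vec; []; _∷_; _[_]≔_)
import Data.Vec.Properties as Vec
open import Level using (0ℓ)
open import Data.Product using (∃; _×_; _,_)
open import Function using (_∘_)
open import Relation.Binary using (Rel; Decidable)
open import Relation.Binary.PropositionalEquality
  using (_≡_; _≢_; refl; sym; trans; cong; cong₂; module ≡-Reasoning)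
open import Relation.Nullary using (yes; no; contradiction)
open import Relation.Nullary.Decidable using (map′)

------------------------------------------------------------------------
-- Polynomials in q over ℤ: a₀ ∷ a₁ ∷ … is a₀ + a₁ q + ….  Trailing zeros
-- are allowed, so equality of polynomials is _≈_, not _≡_.

Poly : Set
Poly = List ℤ

coeff : Poly → ℕ → ℤ
coeff []      _       = 0ℤ
coeff (a ∷ p) zero    = a
coeff (a ∷ p) (suc d) = coeff p d

infix 4 _≈_
_≈_ : Rel Poly 0ℓ
p ≈ p′ = ∀ d → coeff p d ≡ coeff p′ d

infixl 6 _⊕_
_⊕_ : Poly → Poly → Poly
[]      ⊕ p′       = p′
(a ∷ p) ⊕ []       = a ∷ p
(a ∷ p) ⊕ (b ∷ p′) = (a ℤ.+ b) ∷ (p ⊕ p′)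

⊖_ : Poly → Poly
⊖ p = List.map ℤ.-_ p

infixl 7 _⊗_
_⊗_ : Poly → Poly → Poly
[]      ⊗ p′ = []
(a ∷ p) ⊗ p′ = List.map (a ℤ.*_) p′ ⊕ (0ℤ ∷ (p ⊗ p′))

infix 8 q^_
q^_ : ℕ → Poly
q^ e = List.replicate e 0ℤ ++ (1ℤ ∷ [])

∑ : List Poly → Poly
∑ = List.foldr _⊕_ []

-- p ∈ q^e ℕ[q]
infix 4 _∈q^_ℕ[q]
_∈q^_ℕ[q] : Poly → ℕ → Set
p ∈q^ e ℕ[q] = ∃ λ (f : List ℕ) → p ≈ q^ e ⊗ List.map +_ f

HasDegree : Poly → ℕ → Set
HasDegree p d = coeff p d ≢ 0ℤ × (∀ e → d ℕ.< e → coeff p e ≡ 0ℤ)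

------------------------------------------------------------------------
-- Power series in t over ℤ[q]: F m is the coefficient of t^m.

Series : Set
Series = ℕ → Poly

infixl 7 _⊛_
_⊛_ : Series → Series → Series
(F ⊛ G) m = ∑ (List.map (λ i → F i ⊗ G (m ℕ.∸ i)) (List.upTo (suc m)))

1ₛ : Series
1ₛ zero    = q^ 0
1ₛ (suc _) = []

1-q^_t : ℕ → Series
1-q^ a t zero          = q^ 0
1-q^ a t (suc zero)    = ⊖ (q^ a)
1-q^ a t (suc (suc _)) = []

∏ : List Series → Series
∏ = List.foldr _⊛_ 1ₛ

------------------------------------------------------------------------
-- The numerator of the q-zeta series of a finite poset, given by the
-- list P of its elements (without repetition), its order and its rank
-- function.

module QZeta {X : Set} (P : List X) {_≤_ : Rel X 0ℓ} (_≤?_ : Decidable _≤_)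
             (ρ : X → ℕ) where

  tuples : ℕ → List (List X)
  tuples zero    = [] ∷ []
  tuples (suc m) = List.cartesianProductWith _∷_ P (tuples m)

  -- Linked _≤_ (x₁ ∷ … ∷ xₘ ∷ []) means x₁ ≤ x₂, …, xₘ₋₁ ≤ xₘ.
  weakChains : ℕ → List (List X)
  weakChains m = List.filter (linked? _≤?_) (tuples m)

  A : Series
  A m = ∑ (List.map (λ xs → q^ List.sum (List.map ρ xs)) (weakChains m))

  maxRank : ℕ
  maxRank = max 0 (List.map ρ P)

  -- ∏_{a=0}^{H} (1 - q^a t) is invertible as a power series in t, so
  -- ∑ A_m t^m = ℍ / ∏_{a=0}^{H} (1 - q^a t) determines ℍ as this product;
  -- ℍ k is [t^k] ℍ.
  ℍ : Series
  ℍ = ∏ (List.map 1-q^_t (List.upTo (suc maxRank))) ⊛ A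

------------------------------------------------------------------------
-- The root system B_r; all roots lie in the lattice ℤ^r.

infixl 6 _+ᵛ_ _-ᵛ_
infixl 7 _·_

_+ᵛ_ _-ᵛ_ : ∀ {r} → Vec ℤ r → Vec ℤ r → Vec ℤ r
_+ᵛ_ = Vec.zipWith ℤ._+_
_-ᵛ_ = Vec.zipWith ℤ._-_

_·_ : ∀ {r} → ℤ → Vec ℤ r → Vec ℤ r
c · v = Vec.map (c ℤ.*_) v

0ᵛ : ∀ {r} → Vec ℤ r
0ᵛ = Vec.replicate _ 0ℤ

e : ∀ {r} → Fin r → Vec ℤ r
e i = 0ᵛ [ i ]≔ 1ℤ

simpleRoot : ∀ {r} → Fin r → Vec ℤ r
simpleRoot {r} i with suc (toℕ i) ℕ.<? r
... | yes i+1<r = e i -ᵛ e (fromℕ< i+1<r)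
... | no  _     = e i

positiveRoots : ∀ r → List (Vec ℤ r)
positiveRoots r =
     List.map (λ (i , j) → e i -ᵛ e j) pairs
  ++ List.map e (List.allFin r)
  ++ List.map (λ (i , j) → e i +ᵛ e j) pairs
  where
  pairs : List (Fin r × Fin r)
  pairs = List.filter (λ (i , j) → i Fin.<? j)
                      (List.cartesianProduct (List.allFin r) (List.allFin r))

-- ∑ᵢ cᵢ αᵢ
combination : ∀ {r} → Vec ℤ r → Vec ℤ r
combination c = Vec.foldr′ _+ᵛ_ 0ᵛ (Vec.zipWith _·_ c (Vec.tabulate simpleRoot))

infix 4 _≼_
_≼_ : ∀ {r} → Rel (Vec ℤ r) 0ℓ
_≼_ {r} α β = ∃ λ (c : Vec ℕ r) → combination (Vec.map +_ c) ≡ β -ᵛ α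

-- The simple-root coefficients of a vector, namely its partial sums;
-- combination-coefficients and coefficients-combination below show that
-- they exist and are unique.
coefficients : ∀ {r} → Vec ℤ r → Vec ℤ r
coefficients []          = []
coefficients (x ∷ [])    = x ∷ []
coefficients (x ∷ y ∷ v) = x ∷ coefficients ((x ℤ.+ y) ∷ v)

ht : ∀ {r} → Vec ℤ r → ℤ
ht α = Vec.foldr′ ℤ._+_ 0ℤ (coefficients α)

-- Positive roots have height at least 1, so the absolute value only
-- transports ht α - 1 to ℕ.
rk : ∀ {r} → Vec ℤ r → ℕ
rk α = ℤ.∣ ht α ℤ.- 1ℤ ∣

------------------------------------------------------------------------
-- Decidability of _≼_

private
  -ᵛ0 : ∀ {r} (v : Vec ℤ r) → v -ᵛ 0ᵛ ≡ v
  -ᵛ0 []      = refl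
  -ᵛ0 (x ∷ v) = cong₂ _∷_ (ℤ.+-identityʳ x) (-ᵛ0 v)

  simpleRoot-suc : ∀ {r} (i : Fin r) → simpleRoot (suc i) ≡ 0ℤ ∷ simpleRoot i
  simpleRoot-suc {r} i
    with suc (suc (toℕ i)) ℕ.<? suc r | suc (toℕ i) ℕ.<? r
  ... | yes (ℕ.s≤s _) | yes _ = refl
  ... | no  _         | no  _ = refl
  ... | yes (ℕ.s≤s p) | no ¬p = contradiction p ¬p
  ... | no ¬p         | yes p = contradiction (ℕ.s≤s p) ¬p

  fold-shift : ∀ {r n} (c : Vec ℤ n) (v : Fin n → Vec ℤ (suc r))
               (w : Fin n → Vec ℤ r) → (∀ i → v i ≡ 0ℤ ∷ w i) →
               Vec.foldr′ _+ᵛ_ 0ᵛ (Vec.zipWith _·_ c (Vec.tabulate v)) ≡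
               0ℤ ∷ Vec.foldr′ _+ᵛ_ 0ᵛ (Vec.zipWith _·_ c (Vec.tabulate w))
  fold-shift []      v w v≡ = refl
  fold-shift (x ∷ c) v w v≡
    rewrite v≡ zero | fold-shift c (v ∘ suc) (w ∘ suc) (v≡ ∘ suc)
    = cong₂ _∷_ (trans (ℤ.+-identityʳ _) (ℤ.*-zeroʳ x)) refl

  0·+ : ∀ {r} (x : ℤ) (v : Vec ℤ r) → x · 0ᵛ +ᵛ v ≡ v
  0·+ x []      = refl
  0·+ x (y ∷ v) =
    cong₂ _∷_ (trans (cong (ℤ._+ y) (ℤ.*-zeroʳ x)) (ℤ.+-identityˡ y)) (0·+ x v)

  combination-[_] : ∀ x → combination (x ∷ []) ≡ x ∷ []
  combination-[ x ] = cong (_∷ []) (trans (ℤ.+-identityʳ _) (ℤ.*-identityʳ x))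

  combination-∷ : ∀ {r} x (c : Vec ℤ (suc r)) {y v} → combination c ≡ y ∷ v →
                  combination (x ∷ c) ≡ x ∷ (ℤ.- x ℤ.+ y) ∷ v
  combination-∷ x c {y} {v} eq
    rewrite fold-shift c (simpleRoot ∘ suc) simpleRoot simpleRoot-suc | eq
    = cong₂ _∷_ (trans (ℤ.+-identityʳ _) (ℤ.*-identityʳ x))
        (cong₂ _∷_
          (cong (ℤ._+ y) (trans (ℤ.*-comm x _) (ℤ.-1*i≡-i x)))
          (trans (cong (λ z → x · z +ᵛ v) (-ᵛ0 0ᵛ)) (0·+ x v)))

  +-cancel : ∀ x y → x ℤ.+ (ℤ.- x ℤ.+ y) ≡ y
  +-cancel x y = trans (sym (ℤ.+-assoc x (ℤ.- x) y))
                   (trans (cong (ℤ._+ y) (ℤ.+-inverseʳ x)) (ℤ.+-identityˡ y))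

  cancel-+ : ∀ x y → ℤ.- x ℤ.+ (x ℤ.+ y) ≡ y
  cancel-+ x y = trans (sym (ℤ.+-assoc (ℤ.- x) x y))
                   (trans (cong (ℤ._+ y) (ℤ.+-inverseˡ x)) (ℤ.+-identityˡ y))

combination-coefficients : ∀ {r} (v : Vec ℤ r) → combination (coefficients v) ≡ v
combination-coefficients []          = refl
combination-coefficients (x ∷ [])    = combination-[ x ]
combination-coefficients (x ∷ y ∷ v) =
  trans (combination-∷ x (coefficients ((x ℤ.+ y) ∷ v))
           (combination-coefficients ((x ℤ.+ y) ∷ v)))
        (cong (λ z → x ∷ z ∷ v) (cancel-+ x y))

coefficients-combination : ∀ {r} (c : Vec ℤ r) → coefficients (combination c) ≡ c
coefficients-combination []          = refl
coefficients-combination (x ∷ [])    = cong coefficients combination-[ x ]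
coefficients-combination (x ∷ y ∷ c)
  with combination (y ∷ c) in eq | coefficients-combination (y ∷ c)
... | z ∷ v | ih =
  trans (cong coefficients (combination-∷ x (y ∷ c) eq))
        (cong (x ∷_) (trans (cong (λ w → coefficients (w ∷ v)) (+-cancel x z)) ih))

private
  coefficients-unique : ∀ {r} (c : Vec ℕ r) {v} → combination (Vec.map +_ c) ≡ v →
                        Vec.map ℤ.∣_∣ (coefficients v) ≡ c
  coefficients-unique c {v} eq = begin
    Vec.map ℤ.∣_∣ (coefficients v)
      ≡⟨ cong (Vec.map ℤ.∣_∣ ∘ coefficients) (sym eq) ⟩
    Vec.map ℤ.∣_∣ (coefficients (combination (Vec.map +_ c)))
      ≡⟨ cong (Vec.map ℤ.∣_∣) (coefficients-combination (Vec.map +_ c)) ⟩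
    Vec.map ℤ.∣_∣ (Vec.map +_ c)
      ≡⟨ Vec.map-∘ ℤ.∣_∣ +_ c ⟨
    Vec.map (λ x → x) c
      ≡⟨ Vec.map-id c ⟩
    c ∎
    where open ≡-Reasoning

infix 4 _≼?_
_≼?_ : ∀ {r} → Decidable (_≼_ {r})
_≼?_ {r} α β = map′ (c ,_)
  (λ (c′ , eq) → trans (cong (combination ∘ Vec.map +_) (coefficients-unique c′ eq)) eq)
  (Vec.≡-dec ℤ._≟_ (combination (Vec.map +_ c)) (β -ᵛ α))
  where
  c : Vec ℕ r
  c = Vec.map ℤ.∣_∣ (coefficients (β -ᵛ α))

------------------------------------------------------------------------
-- Φ⁺(B_r) graded by rk

ℍ-B : ℕ → Series
ℍ-B r = QZeta.ℍ (positiveRoots r) _≼?_ rk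

-- A positive root of B_r is an interval [a, b] with 1 ≤ a ≤ b and a + b ≤ 2r; the
-- order is inclusion and the rank is b - a.  Inclusion-exclusion over the roots
-- covered by x = [a, b] expresses (1 - q^(b-a) t) times the chain series of the
-- ideal of x through those of [a+1, b], [a, b-1] and their meet [a+1, b-1].  For
-- the numerators N this gives the subtraction-free recursion
--   N[a, b] = N[a, b-1] + M[a, b],  M[a, b] = M[a+1, b] + q^(b-a-1) t N[a+1, b-1],
-- with M[a, b] = 0 on the diagonal a + b = 2r.  Every factor t costs two units of
-- length, which yields positivity and both degree bounds; the top power of q only
-- arises by taking the last summand k times, from [a, b] down to [a+k, b-k].
module Submission where

open import Defs
open import Data.Bool using (Bool; true; false; if_then_else_; _∧_)
open import Data.Fin as Fin using (Fin; toℕ)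
import Data.Fin.Properties as Fin
open import Data.Nat using (ℕ; _+_; _*_; _∸_; _≤_; _≥_)
open import Data.Nat as ℕ using (zero; suc; z≤n; s≤s; _<_; _<?_; _≤?_)
import Data.Nat.Properties as ℕ
import Data.Nat.Tactic.RingSolver as ℕ-Ring
open import Data.Nat.ListAction using (sum)
open import Data.Integer using (1ℤ)
open import Data.Integer as ℤ using (ℤ; +_; 0ℤ)
import Data.Integer.Properties as ℤ
open import Data.Integer.Tactic.RingSolver using (solve-∀)
open import Data.List as List using (List; []; _∷_; _++_)
import Data.List.Properties as List
open import Data.List.Extrema.Nat using (max≤v⁺; v≤max⁺)
open import Data.List.Membership.Propositional using (_∈_; lose)
open import Data.List.Membership.Propositional.Properties
  using (∈-++⁺ʳ; ∈-map⁺; ∈-filter⁺; ∈-cartesianProduct⁺; ∈-allFin)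
open import Data.List.Relation.Unary.All as All using (All)
import Data.List.Relation.Unary.All.Properties as All
import Data.List.Relation.Unary.Any.Properties as Any
open import Data.List.Relation.Unary.Linked using (linked?)
open import Data.Product using (∃; _×_; _,_; proj₁; proj₂)
open import Data.Sum using (_⊎_; inj₁; inj₂)
open import Data.Vec as Vec using (Vec; []; _∷_)
import Data.Vec.Properties as Vec
open import Function using (_∘_; id; mk⇔)
open import Level using (0ℓ)
open import Relation.Binary using (Rel; Decidable)
open import Relation.Binary.PropositionalEquality
open import Relation.Nullary using (Dec; does; yes; no; contradiction; ¬_)
open import Relation.Nullary.Decidable using (does-⇔; dec-true; dec-false; _×-dec_)

-- Over the denominator of [a, b], the meet [a+1, b-1] has two ranks fewer than [a, b] and one fewer
-- than the other two ideals, so inclusion-exclusion reads N[a, b] = N[a+1, b] + N[a, b-1] - (1 -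
-- q^(b-a-1) t) N[a+1, b-1]. The difference M[a+1, b] = N[a+1, b] - N[a+1, b-1] swallows the
-- negative term, and what is left of it enters with a plus sign. Tracking M next to N is what makes
-- positivity an induction. The remaining difficulty is that the definitions offer neither ideals
-- nor intervals: the order is the existence of simple-root coefficients, the roots form three
-- families, and chains are listed from the bottom. In the coordinates u = r - a, v = b - 1 an ideal
-- is the part of a staircase inside a rectangle. Its chain series is defined for every rectangle,
-- also when the corner is no root, so that inclusion-exclusion has one uniform form.

private variable
  X Y : Set

-- Finite sums

∑< : ℕ → (ℕ → ℤ) → ℤ
∑< zero    f = 0ℤ
∑< (suc n) f = ∑< n f ℤ.+ f n

∑ᴸ : List X → (X → ℤ) → ℤ
∑ᴸ []       f = 0ℤ
∑ᴸ (x ∷ xs) f = f x ℤ.+ ∑ᴸ xs f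

-- Iverson bracket: with conditions as factors, sums run over fixed ranges and can be exchanged
-- before a condition cuts them down.
ι : Bool → ℤ → ℤ
ι b x = if b then x else 0ℤ

ι-yes : ∀ {Q : Set} (Q? : Dec Q) → Q → ∀ {x} → ι (does Q?) x ≡ x
ι-yes Q? q {x} = cong (λ b → ι b x) (dec-true Q? q)

ι-no : ∀ {Q : Set} (Q? : Dec Q) → ¬ Q → ∀ {x} → ι (does Q?) x ≡ 0ℤ
ι-no Q? ¬q {x} = cong (λ b → ι b x) (dec-false Q? ¬q)

-- Identities that hold only at genuine roots, such as the rank formula, are applied under the
-- bracket.
ι-cong : ∀ {Q : Set} (Q? : Dec Q) {x y} → (Q → x ≡ y) → ι (does Q?) x ≡ ι (does Q?) y
ι-cong (yes q) x≡y = x≡y q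
ι-cong (no _)  x≡y = refl

ι-⇔ : ∀ {Q Q′ : Set} (Q? : Dec Q) (Q′? : Dec Q′) → (Q → Q′) → (Q′ → Q) →
      ∀ {x y} → x ≡ y → ι (does Q?) x ≡ ι (does Q′?) y
ι-⇔ Q? Q′? to from {x} refl = cong (λ b → ι b x) (does-⇔ (mk⇔ to from) Q? Q′?)

ι-× : ∀ {Q Q′ : Set} (Q? : Dec Q) (Q′? : Dec Q′) b x →
      ι b (ι (does (Q? ×-dec Q′?)) x) ≡ ι (does Q?) (ι (does Q′?) (ι b x))
ι-× (yes _) (yes _) b     x = refl
ι-× (yes _) (no  _) true  x = refl
ι-× (yes _) (no  _) false x = refl
ι-× (no  _) _       true  x = refl
ι-× (no  _) _       false x = refl

ι-∧ : ∀ a b x → ι (a ∧ b) x ≡ ι b (ι a x)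
ι-∧ true  b     x = refl
ι-∧ false true  x = refl
ι-∧ false false x = refl

interchange : ∀ a b c d → (a ℤ.+ b) ℤ.+ (c ℤ.+ d) ≡ (a ℤ.+ c) ℤ.+ (b ℤ.+ d)
interchange = solve-∀

∑<-cong : ∀ n {f g} → (∀ i → i < n → f i ≡ g i) → ∑< n f ≡ ∑< n g
∑<-cong zero    f≡g = refl
∑<-cong (suc n) f≡g =
  cong₂ ℤ._+_ (∑<-cong n λ i i<n → f≡g i (ℕ.m<n⇒m<1+n i<n)) (f≡g n ℕ.≤-refl)

∑<-zero : ∀ n {f} → (∀ i → i < n → f i ≡ 0ℤ) → ∑< n f ≡ 0ℤ
∑<-zero zero    f≡0 = refl
∑<-zero (suc n) f≡0 =
  cong₂ ℤ._+_ (∑<-zero n λ i i<n → f≡0 i (ℕ.m<n⇒m<1+n i<n)) (f≡0 n ℕ.≤-refl)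

∑<-+ : ∀ n f g → ∑< n (λ i → f i ℤ.+ g i) ≡ ∑< n f ℤ.+ ∑< n g
∑<-+ zero    f g = refl
∑<-+ (suc n) f g =
  trans (cong (ℤ._+ (f n ℤ.+ g n)) (∑<-+ n f g)) (interchange (∑< n f) (∑< n g) (f n) (g n))

∑<-sub : ∀ n f g → ∑< n (λ i → f i ℤ.- g i) ≡ ∑< n f ℤ.- ∑< n g
∑<-sub zero    f g = refl
∑<-sub (suc n) f g =
  trans (cong (ℤ._+ (f n ℤ.- g n)) (∑<-sub n f g)) (lemma (∑< n f) (∑< n g) (f n) (g n))
  where
  lemma : ∀ w x y z → (w ℤ.- x) ℤ.+ (y ℤ.- z) ≡ (w ℤ.+ y) ℤ.- (x ℤ.+ z)
  lemma = solve-∀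

∑<-suc : ∀ n f → ∑< (suc n) f ≡ f 0 ℤ.+ ∑< n (f ∘ suc)
∑<-suc zero    f = ℤ.+-comm 0ℤ (f 0)
∑<-suc (suc n) f =
  trans (cong (ℤ._+ f (suc n)) (∑<-suc n f)) (ℤ.+-assoc (f 0) _ _)

∑<-++ : ∀ m n f → ∑< (m + n) f ≡ ∑< m f ℤ.+ ∑< n (λ i → f (m + i))
∑<-++ m zero    f rewrite ℕ.+-identityʳ m = sym (ℤ.+-identityʳ _)
∑<-++ m (suc n) f rewrite ℕ.+-suc m n =
  trans (cong (ℤ._+ f (m + n)) (∑<-++ m n f)) (ℤ.+-assoc (∑< m f) _ _)

∑<-reverse : ∀ n f → ∑< n f ≡ ∑< n (λ i → f (n ∸ suc i))
∑<-reverse zero    f = refl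
∑<-reverse (suc n) f = begin
  ∑< n f ℤ.+ f n                        ≡⟨ ℤ.+-comm (∑< n f) (f n) ⟩
  f n ℤ.+ ∑< n f                        ≡⟨ cong (ℤ._+_ (f n)) (∑<-reverse n f) ⟩
  f n ℤ.+ ∑< n (λ i → f (n ∸ suc i))    ≡⟨ ∑<-suc n (λ i → f (n ∸ i)) ⟨
  ∑< (suc n) (λ i → f (suc n ∸ suc i))  ∎
  where open ≡-Reasoning

∑<-truncate : ∀ {m n} → m ≤ n → ∀ f → ∑< n (λ i → ι (does (i <? m)) (f i)) ≡ ∑< m f
∑<-truncate {m} {zero}  z≤n f = refl
∑<-truncate {m} {suc n} m≤1+n f with ℕ.m≤n⇒m<n∨m≡n m≤1+n
... | inj₁ (s≤s m≤n) rewrite dec-false (n <? m) (ℕ.≤⇒≯ m≤n) =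
  trans (ℤ.+-identityʳ _) (∑<-truncate m≤n f)
... | inj₂ refl = ∑<-cong (suc n) λ i i<m → ι-yes (i <? m) i<m

∑<-ι : ∀ n b f → ∑< n (λ i → ι b (f i)) ≡ ι b (∑< n f)
∑<-ι n true  f = refl
∑<-ι n false f = ∑<-zero n λ _ _ → refl

∑ᴸ-cong : ∀ (xs : List X) {f g} → (∀ x → f x ≡ g x) → ∑ᴸ xs f ≡ ∑ᴸ xs g
∑ᴸ-cong []       f≡g = refl
∑ᴸ-cong (x ∷ xs) f≡g = cong₂ ℤ._+_ (f≡g x) (∑ᴸ-cong xs f≡g)

∑ᴸ-zero : ∀ (xs : List X) → ∑ᴸ xs (λ _ → 0ℤ) ≡ 0ℤ
∑ᴸ-zero []       = refl
∑ᴸ-zero (x ∷ xs) = trans (ℤ.+-identityˡ _) (∑ᴸ-zero xs)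

∑ᴸ-+ : ∀ (xs : List X) f g → ∑ᴸ xs (λ x → f x ℤ.+ g x) ≡ ∑ᴸ xs f ℤ.+ ∑ᴸ xs g
∑ᴸ-+ []       f g = refl
∑ᴸ-+ (x ∷ xs) f g =
  trans (cong (ℤ._+_ (f x ℤ.+ g x)) (∑ᴸ-+ xs f g)) (interchange (f x) (g x) (∑ᴸ xs f) (∑ᴸ xs g))

∑ᴸ-ι : ∀ (xs : List X) b f → ∑ᴸ xs (λ x → ι b (f x)) ≡ ι b (∑ᴸ xs f)
∑ᴸ-ι xs true  f = refl
∑ᴸ-ι xs false f = ∑ᴸ-zero xs

∑ᴸ-swap : ∀ (xs : List X) (ys : List Y) (f : X → Y → ℤ) →
          ∑ᴸ xs (λ x → ∑ᴸ ys (f x)) ≡ ∑ᴸ ys (λ y → ∑ᴸ xs (λ x → f x y))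
∑ᴸ-swap []       ys f = sym (∑ᴸ-zero ys)
∑ᴸ-swap (x ∷ xs) ys f =
  trans (cong (ℤ._+_ (∑ᴸ ys (f x))) (∑ᴸ-swap xs ys f)) (sym (∑ᴸ-+ ys (f x) (λ y → ∑ᴸ xs (λ x′ → f x′ y))))

∑ᴸ-++ : ∀ (xs ys : List X) f → ∑ᴸ (xs ++ ys) f ≡ ∑ᴸ xs f ℤ.+ ∑ᴸ ys f
∑ᴸ-++ []       ys f = sym (ℤ.+-identityˡ _)
∑ᴸ-++ (x ∷ xs) ys f =
  trans (cong (ℤ._+_ (f x)) (∑ᴸ-++ xs ys f)) (sym (ℤ.+-assoc (f x) _ _))

∑ᴸ-map : ∀ (g : X → Y) xs f → ∑ᴸ (List.map g xs) f ≡ ∑ᴸ xs (f ∘ g)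
∑ᴸ-map g []       f = refl
∑ᴸ-map g (x ∷ xs) f = cong (ℤ._+_ (f (g x))) (∑ᴸ-map g xs f)

∑ᴸ-filter : ∀ {Q : X → Set} (Q? : ∀ x → Dec (Q x)) xs f →
            ∑ᴸ (List.filter Q? xs) f ≡ ∑ᴸ xs (λ x → ι (does (Q? x)) (f x))
∑ᴸ-filter Q? []       f = refl
∑ᴸ-filter Q? (x ∷ xs) f with does (Q? x)
... | true  = cong (ℤ._+_ (f x)) (∑ᴸ-filter Q? xs f)
... | false = trans (∑ᴸ-filter Q? xs f) (sym (ℤ.+-identityˡ _))

∑ᴸ-product : ∀ {Z : Set} (g : X → Y → Z) xs ys f →
             ∑ᴸ (List.cartesianProductWith g xs ys) f ≡ ∑ᴸ xs (λ x → ∑ᴸ ys (λ y → f (g x y)))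
∑ᴸ-product g []       ys f = refl
∑ᴸ-product g (x ∷ xs) ys f =
  trans (∑ᴸ-++ (List.map (g x) ys) _ f) (cong₂ ℤ._+_ (∑ᴸ-map (g x) ys f) (∑ᴸ-product g xs ys f))

∑ᴸ-applyUpTo : ∀ (h : ℕ → X) n f → ∑ᴸ (List.applyUpTo h n) f ≡ ∑< n (f ∘ h)
∑ᴸ-applyUpTo h zero    f = refl
∑ᴸ-applyUpTo h (suc n) f =
  trans (cong (ℤ._+_ (f (h 0))) (∑ᴸ-applyUpTo (h ∘ suc) n f)) (sym (∑<-suc n (f ∘ h)))

∑ᴸ-tabulate : ∀ {n} (h : Fin n → X) {f : X → ℤ} (g : ℕ → ℤ) →
              (∀ i → f (h i) ≡ g (toℕ i)) → ∑ᴸ (List.tabulate h) f ≡ ∑< n g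
∑ᴸ-tabulate {n = zero}  h g eq = refl
∑ᴸ-tabulate {n = suc n} h g eq =
  trans (cong₂ ℤ._+_ (eq Fin.zero) (∑ᴸ-tabulate (h ∘ Fin.suc) (g ∘ suc) (eq ∘ Fin.suc)))
        (sym (∑<-suc n g))

-- Coefficient sequences in q

Seq : Set
Seq = ℕ → ℤ

δ : Seq
δ zero    = 1ℤ
δ (suc _) = 0ℤ

-- multiplication by q^a
sh : ℕ → Seq → Seq
sh zero    f d       = f d
sh (suc a) f zero    = 0ℤ
sh (suc a) f (suc d) = sh a f d

sh-cong : ∀ a {f g : Seq} → f ≗ g → sh a f ≗ sh a g
sh-cong zero    f≗g d       = f≗g d
sh-cong (suc a) f≗g zero    = refl
sh-cong (suc a) f≗g (suc d) = sh-cong a f≗g d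

sh-0 : ∀ a → sh a (λ _ → 0ℤ) ≗ (λ _ → 0ℤ)
sh-0 zero    d       = refl
sh-0 (suc a) zero    = refl
sh-0 (suc a) (suc d) = sh-0 a d

sh-+ : ∀ a f g → sh a (λ d → f d ℤ.+ g d) ≗ (λ d → sh a f d ℤ.+ sh a g d)
sh-+ zero    f g d       = refl
sh-+ (suc a) f g zero    = refl
sh-+ (suc a) f g (suc d) = sh-+ a f g d

sh-sub : ∀ a f g → sh a (λ d → f d ℤ.- g d) ≗ (λ d → sh a f d ℤ.- sh a g d)
sh-sub zero    f g d       = refl
sh-sub (suc a) f g zero    = refl
sh-sub (suc a) f g (suc d) = sh-sub a f g d

sh-sh : ∀ a b f → sh a (sh b f) ≗ sh (a + b) f
sh-sh zero    b f d       = refl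
sh-sh (suc a) b f zero    = refl
sh-sh (suc a) b f (suc d) = sh-sh a b f d

sh-comm : ∀ a b f → sh a (sh b f) ≗ sh b (sh a f)
sh-comm a b f d = begin
  sh a (sh b f) d ≡⟨ sh-sh a b f d ⟩
  sh (a + b) f d  ≡⟨ cong (λ c → sh c f d) (ℕ.+-comm a b) ⟩
  sh (b + a) f d  ≡⟨ sh-sh b a f d ⟨
  sh b (sh a f) d ∎
  where open ≡-Reasoning

sh-ι : ∀ a b f → sh a (λ d → ι b (f d)) ≗ (λ d → ι b (sh a f d))
sh-ι a true  f d = refl
sh-ι a false f d = sh-0 a d

sh-∑< : ∀ a n (f : ℕ → Seq) → sh a (λ d → ∑< n (λ i → f i d)) ≗ (λ d → ∑< n (λ i → sh a (f i) d))
sh-∑< a zero    f d = sh-0 a d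
sh-∑< a (suc n) f d = trans (sh-+ a _ (f n) d) (cong (ℤ._+ sh a (f n) d) (sh-∑< a n f d))

sh-∑ᴸ : ∀ a (xs : List X) (f : X → Seq) →
        sh a (λ d → ∑ᴸ xs (λ x → f x d)) ≗ (λ d → ∑ᴸ xs (λ x → sh a (f x) d))
sh-∑ᴸ a []       f d = sh-0 a d
sh-∑ᴸ a (x ∷ xs) f d = trans (sh-+ a (f x) _ d) (cong (ℤ._+_ (sh a (f x) d)) (sh-∑ᴸ a xs f d))

-- The recursion peels the left factor, as `_⊗_` does, so the algebraic laws are needed in that
-- factor only.
conv : Seq → Seq → Seq
conv f g zero    = f 0 ℤ.* g 0
conv f g (suc d) = f 0 ℤ.* g (suc d) ℤ.+ conv (f ∘ suc) g d

conv-cong : ∀ {f f′ g g′} → f ≗ f′ → g ≗ g′ → conv f g ≗ conv f′ g′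
conv-cong f≗ g≗ zero    = cong₂ ℤ._*_ (f≗ 0) (g≗ 0)
conv-cong f≗ g≗ (suc d) =
  cong₂ ℤ._+_ (cong₂ ℤ._*_ (f≗ 0) (g≗ (suc d))) (conv-cong (f≗ ∘ suc) g≗ d)

conv-0 : ∀ g → conv (λ _ → 0ℤ) g ≗ (λ _ → 0ℤ)
conv-0 g zero    = ℤ.*-zeroˡ (g 0)
conv-0 g (suc d) = cong₂ ℤ._+_ (ℤ.*-zeroˡ (g (suc d))) (conv-0 g d)

conv-δ : ∀ g → conv δ g ≗ g
conv-δ g zero    = ℤ.*-identityˡ (g 0)
conv-δ g (suc d) = trans (cong₂ ℤ._+_ (ℤ.*-identityˡ (g (suc d))) (conv-0 g d)) (ℤ.+-identityʳ _)

conv-sub : ∀ f f′ g → conv (λ d → f d ℤ.- f′ d) g ≗ (λ d → conv f g d ℤ.- conv f′ g d)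
conv-sub f f′ g zero    = distrib (f 0) (f′ 0) (g 0)
  where
  distrib : ∀ x y z → (x ℤ.- y) ℤ.* z ≡ x ℤ.* z ℤ.- y ℤ.* z
  distrib = solve-∀
conv-sub f f′ g (suc d) =
  trans (cong (ℤ._+_ ((f 0 ℤ.- f′ 0) ℤ.* g (suc d))) (conv-sub (f ∘ suc) (f′ ∘ suc) g d))
        (distrib (f 0) (f′ 0) (g (suc d)) (conv (f ∘ suc) g d) (conv (f′ ∘ suc) g d))
  where
  distrib : ∀ x y z u v → (x ℤ.- y) ℤ.* z ℤ.+ (u ℤ.- v) ≡ (x ℤ.* z ℤ.+ u) ℤ.- (y ℤ.* z ℤ.+ v)
  distrib = solve-∀

conv-sh : ∀ a f g → conv (sh a f) g ≗ sh a (conv f g)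
conv-sh zero    f g d       = refl
conv-sh (suc a) f g zero    = ℤ.*-zeroˡ (g 0)
conv-sh (suc a) f g (suc d) =
  trans (cong₂ ℤ._+_ (ℤ.*-zeroˡ (g (suc d))) (conv-sh a f g d)) (ℤ.+-identityˡ _)

coeff-⊕ : ∀ p p′ d → coeff (p ⊕ p′) d ≡ coeff p d ℤ.+ coeff p′ d
coeff-⊕ []      p′       d       = sym (ℤ.+-identityˡ _)
coeff-⊕ (a ∷ p) []       d       = sym (ℤ.+-identityʳ _)
coeff-⊕ (a ∷ p) (b ∷ p′) zero    = refl
coeff-⊕ (a ∷ p) (b ∷ p′) (suc d) = coeff-⊕ p p′ d

coeff-map : ∀ (h : ℤ → ℤ) → h 0ℤ ≡ 0ℤ → ∀ p d → coeff (List.map h p) d ≡ h (coeff p d)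
coeff-map h h0 []      d       = sym h0
coeff-map h h0 (a ∷ p) zero    = refl
coeff-map h h0 (a ∷ p) (suc d) = coeff-map h h0 p d

coeff-⊗ : ∀ p p′ d → coeff (p ⊗ p′) d ≡ conv (coeff p) (coeff p′) d
coeff-⊗ []      p′ d       = sym (conv-0 (coeff p′) d)
coeff-⊗ (a ∷ p) p′ zero    =
  trans (coeff-⊕ (List.map (a ℤ.*_) p′) _ 0)
        (trans (ℤ.+-identityʳ _) (coeff-map (a ℤ.*_) (ℤ.*-zeroʳ a) p′ 0))
coeff-⊗ (a ∷ p) p′ (suc d) =
  trans (coeff-⊕ (List.map (a ℤ.*_) p′) _ (suc d))
        (cong₂ ℤ._+_ (coeff-map (a ℤ.*_) (ℤ.*-zeroʳ a) p′ (suc d)) (coeff-⊗ p p′ d))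

coeff-q^ : ∀ a d → coeff (q^ a) d ≡ sh a δ d
coeff-q^ zero    zero    = refl
coeff-q^ zero    (suc d) = refl
coeff-q^ (suc a) zero    = refl
coeff-q^ (suc a) (suc d) = coeff-q^ a d

coeff-∑ : ∀ (g : X → Poly) xs d → coeff (∑ (List.map g xs)) d ≡ ∑ᴸ xs (λ x → coeff (g x) d)
coeff-∑ g []       d = refl
coeff-∑ g (x ∷ xs) d = trans (coeff-⊕ (g x) _ d) (cong (ℤ._+_ (coeff (g x) d)) (coeff-∑ g xs d))

-- Coefficient arrays of power series in t

Arr : Set
Arr = ℕ → Seq

infix 4 _≐_
_≐_ : Rel Arr 0ℓ
F ≐ G = ∀ m → F m ≗ G m

≐-trans : ∀ {F G H} → F ≐ G → G ≐ H → F ≐ H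
≐-trans F≐G G≐H m d = trans (F≐G m d) (G≐H m d)

≐-sym : ∀ {F G} → F ≐ G → G ≐ F
≐-sym F≐G m d = sym (F≐G m d)

⟦_⟧ : Series → Arr
⟦ F ⟧ m d = coeff (F m) d

1ᴬ : Arr
1ᴬ zero    = δ
1ᴬ (suc _) = λ _ → 0ℤ

infixl 6 _+ᴬ_ _-ᴬ_
_+ᴬ_ _-ᴬ_ : Arr → Arr → Arr
(F +ᴬ G) m d = F m d ℤ.+ G m d
(F -ᴬ G) m d = F m d ℤ.- G m d

-- multiplication by q^a t and by 1 - q^a t
S T : ℕ → Arr → Arr
S a F zero    = λ _ → 0ℤ
S a F (suc m) = sh a (F m)
T a F = F -ᴬ S a F

S-cong : ∀ a {F G} → F ≐ G → S a F ≐ S a G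
S-cong a F≐G zero    d = refl
S-cong a F≐G (suc m) d = sh-cong a (F≐G m) d

S-+ : ∀ a F G → S a (F +ᴬ G) ≐ S a F +ᴬ S a G
S-+ a F G zero    d = refl
S-+ a F G (suc m) d = sh-+ a (F m) (G m) d

S-sub : ∀ a F G → S a (F -ᴬ G) ≐ S a F -ᴬ S a G
S-sub a F G zero    d = refl
S-sub a F G (suc m) d = sh-sub a (F m) (G m) d

S-comm : ∀ a b F → S a (S b F) ≐ S b (S a F)
S-comm a b F zero          d = refl
S-comm a b F (suc zero)    d = trans (sh-0 a d) (sym (sh-0 b d))
S-comm a b F (suc (suc m)) d = sh-comm a b (F m) d

T-cong : ∀ a {F G} → F ≐ G → T a F ≐ T a G
T-cong a F≐G m d = cong₂ ℤ._-_ (F≐G m d) (S-cong a F≐G m d)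

T-+ : ∀ a F G → T a (F +ᴬ G) ≐ T a F +ᴬ T a G
T-+ a F G m d =
  trans (cong (λ z → F m d ℤ.+ G m d ℤ.- z) (S-+ a F G m d))
        (lemma (F m d) (G m d) (S a F m d) (S a G m d))
  where
  lemma : ∀ w x y z → (w ℤ.+ x) ℤ.- (y ℤ.+ z) ≡ (w ℤ.- y) ℤ.+ (x ℤ.- z)
  lemma = solve-∀

sub-interchange : ∀ w x y z → (w ℤ.- x) ℤ.- (y ℤ.- z) ≡ (w ℤ.- y) ℤ.- (x ℤ.- z)
sub-interchange = solve-∀

T-sub : ∀ a F G → T a (F -ᴬ G) ≐ T a F -ᴬ T a G
T-sub a F G m d =
  trans (cong (λ z → F m d ℤ.- G m d ℤ.- z) (S-sub a F G m d))
        (sub-interchange (F m d) (G m d) (S a F m d) (S a G m d))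

T-comm : ∀ a b F → T a (T b F) ≐ T b (T a F)
T-comm a b F m d = begin
  F m d ℤ.- S b F m d ℤ.- S a (T b F) m d
    ≡⟨ cong (λ z → F m d ℤ.- S b F m d ℤ.- z) (S-sub a F (S b F) m d) ⟩
  F m d ℤ.- S b F m d ℤ.- (S a F m d ℤ.- S a (S b F) m d)
    ≡⟨ sub-interchange (F m d) (S b F m d) (S a F m d) _ ⟩
  F m d ℤ.- S a F m d ℤ.- (S b F m d ℤ.- S a (S b F) m d)
    ≡⟨ cong (λ z → F m d ℤ.- S a F m d ℤ.- (S b F m d ℤ.- z)) (S-comm a b F m d) ⟩
  F m d ℤ.- S a F m d ℤ.- (S b F m d ℤ.- S b (S a F) m d)
    ≡⟨ cong (λ z → F m d ℤ.- S a F m d ℤ.- z) (S-sub b F (S a F) m d) ⟨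
  F m d ℤ.- S a F m d ℤ.- S b (T a F) m d ∎
  where open ≡-Reasoning

-- multiplication by ∏_{a<L} (1 - q^a t)
Tⁿ : ℕ → Arr → Arr
Tⁿ zero    F = F
Tⁿ (suc L) F = Tⁿ L (T L F)

Tⁿ-cong : ∀ L {F G} → F ≐ G → Tⁿ L F ≐ Tⁿ L G
Tⁿ-cong zero    F≐G = F≐G
Tⁿ-cong (suc L) F≐G = Tⁿ-cong L (T-cong L F≐G)

Tⁿ-+ : ∀ L F G → Tⁿ L (F +ᴬ G) ≐ Tⁿ L F +ᴬ Tⁿ L G
Tⁿ-+ zero    F G m d = refl
Tⁿ-+ (suc L) F G = ≐-trans (Tⁿ-cong L (T-+ L F G)) (Tⁿ-+ L (T L F) (T L G))

Tⁿ-sub : ∀ L F G → Tⁿ L (F -ᴬ G) ≐ Tⁿ L F -ᴬ Tⁿ L G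
Tⁿ-sub zero    F G m d = refl
Tⁿ-sub (suc L) F G = ≐-trans (Tⁿ-cong L (T-sub L F G)) (Tⁿ-sub L (T L F) (T L G))

-- Needed for the ideal of the meet, which is multiplied by one factor more than its own denominator
-- contains.
Tⁿ-T : ∀ L a F → Tⁿ L (T a F) ≐ T a (Tⁿ L F)
Tⁿ-T zero    a F m d = refl
Tⁿ-T (suc L) a F = ≐-trans (Tⁿ-cong L (T-comm L a F)) (Tⁿ-T L a (T L F))

-- Products of series as iterated operators

conv² : Arr → Arr → Arr
conv² F G m d = ∑< (suc m) (λ i → conv (F i) (G (m ∸ i)) d)

coeff-⊛ : ∀ F G → ⟦ F ⊛ G ⟧ ≐ conv² ⟦ F ⟧ ⟦ G ⟧
coeff-⊛ F G m d = begin
  coeff ((F ⊛ G) m) d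
    ≡⟨ coeff-∑ (λ i → F i ⊗ G (m ∸ i)) (List.upTo (suc m)) d ⟩
  ∑ᴸ (List.upTo (suc m)) (λ i → coeff (F i ⊗ G (m ∸ i)) d)
    ≡⟨ ∑ᴸ-applyUpTo id (suc m) _ ⟩
  ∑< (suc m) (λ i → coeff (F i ⊗ G (m ∸ i)) d)
    ≡⟨ ∑<-cong (suc m) (λ i _ → coeff-⊗ (F i) (G (m ∸ i)) d) ⟩
  conv² ⟦ F ⟧ ⟦ G ⟧ m d ∎
  where open ≡-Reasoning

conv²-congˡ : ∀ {F F′} G → F ≐ F′ → conv² F G ≐ conv² F′ G
conv²-congˡ G F≐F′ m d =
  ∑<-cong (suc m) (λ i _ → conv-cong (F≐F′ i) (λ _ → refl) d)

conv²-1 : ∀ G → conv² 1ᴬ G ≐ G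
conv²-1 G m d = begin
  conv² 1ᴬ G m d                ≡⟨ ∑<-suc m (λ i → conv (1ᴬ i) (G (m ∸ i)) d) ⟩
  conv δ (G m) d ℤ.+ ∑< m _     ≡⟨ cong₂ ℤ._+_ (conv-δ (G m) d) (∑<-zero m λ i _ → conv-0 (G (m ∸ suc i)) d) ⟩
  G m d ℤ.+ 0ℤ                  ≡⟨ ℤ.+-identityʳ _ ⟩
  G m d                         ∎
  where open ≡-Reasoning

conv²-S : ∀ a F G → conv² (S a F) G ≐ S a (conv² F G)
conv²-S a F G zero    d = trans (ℤ.+-identityˡ _) (conv-0 (G 0) d)
conv²-S a F G (suc m) d = begin
  conv² (S a F) G (suc m) d
    ≡⟨ ∑<-suc (suc m) (λ i → conv (S a F i) (G (suc m ∸ i)) d) ⟩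
  conv (λ _ → 0ℤ) (G (suc m)) d ℤ.+ ∑< (suc m) (λ i → conv (sh a (F i)) (G (m ∸ i)) d)
    ≡⟨ cong₂ ℤ._+_ (conv-0 (G (suc m)) d) (∑<-cong (suc m) λ i _ → conv-sh a (F i) (G (m ∸ i)) d) ⟩
  0ℤ ℤ.+ ∑< (suc m) (λ i → sh a (conv (F i) (G (m ∸ i))) d)
    ≡⟨ ℤ.+-identityˡ _ ⟩
  ∑< (suc m) (λ i → sh a (conv (F i) (G (m ∸ i))) d)
    ≡⟨ sh-∑< a (suc m) (λ i → conv (F i) (G (m ∸ i))) d ⟨
  sh a (conv² F G m) d ∎
  where open ≡-Reasoning

-- Linear factors pass out of a product one at a time, so the denominator acts on `A` through the
-- operators `T` and is never expanded.
conv²-T : ∀ a F G → conv² (T a F) G ≐ T a (conv² F G)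
conv²-T a F G m d = begin
  conv² (T a F) G m d
    ≡⟨ ∑<-cong (suc m) (λ i _ → conv-sub (F i) (S a F i) (G (m ∸ i)) d) ⟩
  ∑< (suc m) (λ i → conv (F i) (G (m ∸ i)) d ℤ.- conv (S a F i) (G (m ∸ i)) d)
    ≡⟨ ∑<-sub (suc m) (λ i → conv (F i) (G (m ∸ i)) d) _ ⟩
  conv² F G m d ℤ.- conv² (S a F) G m d
    ≡⟨ cong (λ z → conv² F G m d ℤ.- z) (conv²-S a F G m d) ⟩
  T a (conv² F G) m d ∎
  where open ≡-Reasoning

⟦1-q^t⟧ : ∀ a → ⟦ 1-q^ a t ⟧ ≐ T a 1ᴬ
⟦1-q^t⟧ a zero          d = trans (coeff-q^ 0 d) (sym (ℤ.+-identityʳ _))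
⟦1-q^t⟧ a (suc zero)    d =
  trans (coeff-map ℤ.-_ refl (q^ a) d)
        (trans (cong ℤ.-_ (coeff-q^ a d)) (sym (ℤ.+-identityˡ _)))
⟦1-q^t⟧ a (suc (suc m)) d = sym (trans (ℤ.+-identityˡ _) (cong ℤ.-_ (sh-0 a d)))

⟦1-q^t⊛⟧ : ∀ a F → ⟦ 1-q^ a t ⊛ F ⟧ ≐ T a ⟦ F ⟧
⟦1-q^t⊛⟧ a F =
  ≐-trans (coeff-⊛ (1-q^ a t) F)
  (≐-trans (conv²-congˡ ⟦ F ⟧ (⟦1-q^t⟧ a))
  (≐-trans (conv²-T a 1ᴬ ⟦ F ⟧) (T-cong a (conv²-1 ⟦ F ⟧))))

⟦∏⊛⟧ : ∀ as F → ⟦ ∏ (List.map 1-q^_t as) ⊛ F ⟧ ≐ List.foldr T ⟦ F ⟧ as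
⟦∏⊛⟧ []       F =
  ≐-trans (coeff-⊛ 1ₛ F) (≐-trans (conv²-congˡ ⟦ F ⟧ ⟦1ₛ⟧) (conv²-1 ⟦ F ⟧))
  where
  ⟦1ₛ⟧ : ⟦ 1ₛ ⟧ ≐ 1ᴬ
  ⟦1ₛ⟧ zero    d = coeff-q^ 0 d
  ⟦1ₛ⟧ (suc m) d = refl
⟦∏⊛⟧ (a ∷ as) F =
  ≐-trans (coeff-⊛ (1-q^ a t ⊛ Π) F)
  (≐-trans (conv²-congˡ ⟦ F ⟧ (⟦1-q^t⊛⟧ a Π))
  (≐-trans (conv²-T a ⟦ Π ⟧ ⟦ F ⟧)
           (T-cong a (≐-trans (≐-sym (coeff-⊛ Π F)) (⟦∏⊛⟧ as F)))))
  where
  Π : Series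
  Π = ∏ (List.map 1-q^_t as)

foldr-T-upTo : ∀ L F → List.foldr T F (List.upTo L) ≡ Tⁿ L F
foldr-T-upTo zero    F = refl
foldr-T-upTo (suc L) F = begin
  List.foldr T F (List.upTo (suc L))             ≡⟨ cong (List.foldr T F) (List.upTo-∷ʳ L) ⟨
  List.foldr T F (List.upTo L List.∷ʳ L)         ≡⟨ List.foldr-++ T F (List.upTo L) (L ∷ []) ⟩
  List.foldr T (T L F) (List.upTo L)             ≡⟨ foldr-T-upTo L (T L F) ⟩
  Tⁿ (suc L) F                                   ∎
  where open ≡-Reasoning

-- The numerators attached to principal order ideals

-- N c L and M c L belong to the root with (1-based) interval [a, b], where
-- a + b + c = 2r and L = b - a + 1: N is the numerator of its principal ideal,
-- and M is N minus the numerator of the ideal of [a, b - 1].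
mutual
  N : ℕ → ℕ → Arr
  N c zero    = 1ᴬ
  N c (suc L) = N (suc c) L +ᴬ M c (suc L)

  M : ℕ → ℕ → Arr
  M zero    L             = λ _ _ → 0ℤ
  M (suc c) zero          = λ _ _ → 0ℤ
  M (suc c) (suc zero)    = λ _ _ → 0ℤ
  M (suc c) (suc (suc L)) = M c (suc L) +ᴬ S L (N (suc c) L)

-- Nonnegativity and support of the numerators

sh-cases : ∀ a f d → sh a f d ≡ 0ℤ ⊎ ∃ λ d′ → d ≡ a + d′ × sh a f d ≡ f d′
sh-cases zero    f d       = inj₂ (d , refl , refl)
sh-cases (suc a) f zero    = inj₁ refl
sh-cases (suc a) f (suc d) with sh-cases a f d
... | inj₁ sh≡0            = inj₁ sh≡0
... | inj₂ (d′ , refl , p) = inj₂ (d′ , refl , p)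

sh-at : ∀ a f d → sh a f (a + d) ≡ f d
sh-at zero    f d = refl
sh-at (suc a) f d = sh-at a f d

-- For L = 2k + s the exponents of [t^k] (N c L) lie in [k(k-1), k(k-1) + ks],
-- and [t^k] (N c L) = 0 for L < 2k.
data Supp (k L d : ℕ) : Set where
  supp : ∀ s x → L ≡ 2 * k + s → d ≡ k * (k ∸ 1) + x → x ≤ k * s → Supp k L d

-- One invariant for nonnegativity and both exponent bounds: they survive the same three operations
-- of the recursion, namely sums, a longer `L`, and multiplication by `q^L t`.
Good : ℕ → ℕ → Seq → Set
Good k L f = ∀ d → ∃ λ a → f d ≡ + a × (a ≡ 0 ⊎ Supp k L d)

Good-0 : ∀ {k L} → Good k L (λ _ → 0ℤ)
Good-0 d = 0 , refl , inj₁ refl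

Good-1 : ∀ k L → Good k L (1ᴬ k)
Good-1 (suc k) L d       = 0 , refl , inj₁ refl
Good-1 zero    L (suc d) = 0 , refl , inj₁ refl
Good-1 zero    L zero    = 1 , refl , inj₂ (supp L 0 refl refl z≤n)

Good-+ : ∀ {k L f g} → Good k L f → Good k L g → Good k L (λ d → f d ℤ.+ g d)
Good-+ F G d with F d | G d
... | a , f≡ , inj₁ refl | b , g≡ , q      = b , cong₂ ℤ._+_ f≡ g≡ , q
... | a , f≡ , inj₂ p    | b , g≡ , _      = a + b , cong₂ ℤ._+_ f≡ g≡ , inj₂ p

Good-suc : ∀ {k L f} → Good k L f → Good k (suc L) f
Good-suc {k} F d with F d
... | a , f≡ , inj₁ a≡0 = a , f≡ , inj₁ a≡0
... | a , f≡ , inj₂ (supp s x refl d≡ x≤ks) =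
  a , f≡ , inj₂ (supp (suc s) x (sym (ℕ.+-suc (2 * k) s)) d≡ (ℕ.≤-trans x≤ks (ℕ.*-monoʳ-≤ k (ℕ.n≤1+n s))))

k[k∸1]+k≡k*k : ∀ k → k * (k ∸ 1) + k ≡ k * k
k[k∸1]+k≡k*k zero    = refl
k[k∸1]+k≡k*k (suc k) = lemma k
  where
  lemma : ∀ k → suc k * k + suc k ≡ suc k * suc k
  lemma = ℕ-Ring.solve-∀

-- Of the shift `L = 2k + s`, the part `2k` raises the base `k(k-1)` to `(k+1)k`, and `s` is added
-- to the offset.
shift-exponent : ∀ k s x → 2 * k + s + (k * (k ∸ 1) + x) ≡ suc k * k + (s + x)
shift-exponent k s x = begin
  2 * k + s + (k * (k ∸ 1) + x)    ≡⟨ lemma₁ k s x (k * (k ∸ 1)) ⟩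
  k * (k ∸ 1) + k + k + (s + x)    ≡⟨ cong (λ y → y + k + (s + x)) (k[k∸1]+k≡k*k k) ⟩
  k * k + k + (s + x)              ≡⟨ cong (_+ (s + x)) (ℕ.+-comm (k * k) k) ⟩
  suc k * k + (s + x)              ∎
  where
  open ≡-Reasoning
  lemma₁ : ∀ k s x y → 2 * k + s + (y + x) ≡ y + k + k + (s + x)
  lemma₁ = ℕ-Ring.solve-∀

2*suc : ∀ k s → suc (suc (2 * k + s)) ≡ 2 * suc k + s
2*suc = ℕ-Ring.solve-∀

-- Two units of length pay for the extra factor `t`, so `s` is unchanged, and `x ≤ ks` becomes
-- exactly `s + x ≤ (k+1)s`.
Good-sh : ∀ {k L f} → Good k L f → Good (suc k) (suc (suc L)) (sh L f)
Good-sh {k} {L} {f} F d with sh-cases L f d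
... | inj₁ sh≡0 = 0 , sh≡0 , inj₁ refl
... | inj₂ (d′ , refl , sh≡f) with F d′
...   | a , f≡ , inj₁ a≡0 = a , trans sh≡f f≡ , inj₁ a≡0
...   | a , f≡ , inj₂ (supp s x refl refl x≤ks) =
  a , trans sh≡f f≡ ,
  inj₂ (supp s (s + x) (2*suc k s) (shift-exponent k s x) (ℕ.+-monoʳ-≤ s x≤ks))

Good-S : ∀ {k L F} → (∀ k → Good k L (F k)) → Good k (suc (suc L)) (S L F k)
Good-S {zero}  G = Good-0
Good-S {suc k} G = Good-sh (G k)

mutual
  Good-N : ∀ c L k → Good k L (N c L k)
  Good-N c zero    k = Good-1 k 0
  Good-N c (suc L) k = Good-+ (Good-suc (Good-N (suc c) L k)) (Good-M c (suc L) k)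

  Good-M : ∀ c L k → Good k L (M c L k)
  Good-M zero    L             k = Good-0
  Good-M (suc c) zero          k = Good-0
  Good-M (suc c) (suc zero)    k = Good-0
  Good-M (suc c) (suc (suc L)) k = Good-+ (Good-suc (Good-M c (suc L) k)) (Good-S (Good-N (suc c) L))

Good⇒deg≤ : ∀ {k s f} → Good k (2 * k + s) f → ∀ d → k * (k ∸ 1) + k * s < d → f d ≡ 0ℤ
Good⇒deg≤ {k} {s} F d top<d with F d
... | a , f≡ , inj₁ refl = f≡
... | a , f≡ , inj₂ (supp s′ x L≡ refl x≤) with ℕ.+-cancelˡ-≡ (2 * k) s s′ L≡
...   | refl = contradiction (ℕ.+-monoʳ-≤ (k * (k ∸ 1)) x≤) (ℕ.<⇒≱ top<d)

-- One unit less of length lowers `s` by one and the degree bound by the positive number `suc k`, so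
-- the top exponent is out of reach.
Good⇒top≡0 : ∀ {k s L f} → Good (suc k) L f → suc L ≡ 2 * suc k + s →
             f (suc k * k + suc k * s) ≡ 0ℤ
Good⇒top≡0 {k} {s} F L≡ with F (suc k * k + suc k * s)
... | a , f≡ , inj₁ refl = f≡
... | a , f≡ , inj₂ (supp s′ x refl d≡ x≤)
  with ℕ.+-cancelˡ-≡ (suc k * k) _ _ d≡
     | ℕ.+-cancelˡ-≡ (2 * suc k) _ _ (trans (ℕ.+-suc (2 * suc k) s′) L≡)
...   | refl | refl = contradiction x≤ (ℕ.<⇒≱ (ℕ.*-monoʳ-< (suc k) (ℕ.n<1+n s′)))

-- Constant terms and top coefficients

mutual
  N-constant : ∀ c L → N c L 0 ≗ δ
  N-constant c zero    d = refl
  N-constant c (suc L) d =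
    trans (cong₂ ℤ._+_ (N-constant (suc c) L d) (M-constant c (suc L) d)) (ℤ.+-identityʳ _)

  M-constant : ∀ c L → M c L 0 ≗ (λ _ → 0ℤ)
  M-constant zero    L             d = refl
  M-constant (suc c) zero          d = refl
  M-constant (suc c) (suc zero)    d = refl
  M-constant (suc c) (suc (suc L)) d = cong (ℤ._+ 0ℤ) (M-constant c (suc L) d)

-- Two of the three summands are one unit shorter and miss the top exponent. The third keeps both
-- `s` and `suc c`, so the induction closes; it is absent on the diagonal, hence the index `suc c`.
N-top : ∀ k s c L → L ≡ 2 * k + s → N (suc c) L k (k * (k ∸ 1) + k * s) ≡ 1ℤ
N-top zero    s c L L≡ = N-constant (suc c) L 0
N-top (suc k) s c L L≡ with trans L≡ (sym (2*suc k s))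
... | refl = begin
  N (suc (suc c)) (suc L′) (suc k) d ℤ.+ (M c (suc L′) (suc k) d ℤ.+ sh L′ (N (suc c) L′ k) d)
    ≡⟨ cong₂ ℤ._+_ (Good⇒top≡0 (Good-N (suc (suc c)) (suc L′) (suc k)) L≡)
                   (cong (ℤ._+ sh L′ (N (suc c) L′ k) d) (Good⇒top≡0 (Good-M c (suc L′) (suc k)) L≡)) ⟩
  0ℤ ℤ.+ (0ℤ ℤ.+ sh L′ (N (suc c) L′ k) d)
    ≡⟨ trans (ℤ.+-identityˡ _) (ℤ.+-identityˡ _) ⟩
  sh L′ (N (suc c) L′ k) d
    ≡⟨ cong (sh L′ (N (suc c) L′ k)) (shift-exponent k s (k * s)) ⟨
  sh L′ (N (suc c) L′ k) (L′ + (k * (k ∸ 1) + k * s))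
    ≡⟨ sh-at L′ (N (suc c) L′ k) _ ⟩
  N (suc c) L′ k (k * (k ∸ 1) + k * s)
    ≡⟨ N-top k s c L′ refl ⟩
  1ℤ ∎
  where
  open ≡-Reasoning
  L′ d : ℕ
  L′ = 2 * k + s
  d = suc k * k + suc k * s

-- From coefficient sequences back to polynomials

coeff-q^⊗ : ∀ a p d → coeff (q^ a ⊗ p) d ≡ sh a (coeff p) d
coeff-q^⊗ a p d = begin
  coeff (q^ a ⊗ p) d             ≡⟨ coeff-⊗ (q^ a) p d ⟩
  conv (coeff (q^ a)) (coeff p) d ≡⟨ conv-cong (coeff-q^ a) (λ _ → refl) d ⟩
  conv (sh a δ) (coeff p) d      ≡⟨ conv-sh a δ (coeff p) d ⟩
  sh a (conv δ (coeff p)) d      ≡⟨ sh-cong a (conv-δ (coeff p)) d ⟩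
  sh a (coeff p) d               ∎
  where open ≡-Reasoning

coeff-applyUpTo : ∀ (g : ℕ → ℕ) n → (∀ i → n ≤ i → g i ≡ 0) →
                  ∀ i → coeff (List.map +_ (List.applyUpTo g n)) i ≡ + g i
coeff-applyUpTo g zero    g≡0 i       = cong +_ (sym (g≡0 i z≤n))
coeff-applyUpTo g (suc n) g≡0 zero    = refl
coeff-applyUpTo g (suc n) g≡0 (suc i) =
  coeff-applyUpTo (g ∘ suc) n (λ j n≤j → g≡0 (suc j) (s≤s n≤j)) i

-- The witness lists the `k * s + 1` coefficients from exponent `k(k-1)` on; the support condition
-- makes all others zero.
Good⇒∈q^ℕ[q] : ∀ {k s p} → Good k (2 * k + s) (coeff p) → p ∈q^ (k * (k ∸ 1)) ℕ[q]
Good⇒∈q^ℕ[q] {k} {s} {p} G = List.applyUpTo g (suc (k * s)) , λ d →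
  trans (coeff≡ d) (sym (trans (coeff-q^⊗ b _ d) (sh-cong b (coeff-applyUpTo g (suc (k * s)) g≡0) d)))
  where
  b : ℕ
  b = k * (k ∸ 1)
  g : ℕ → ℕ
  g i = ℤ.∣ coeff p (b + i) ∣
  g≡0 : ∀ i → k * s < i → g i ≡ 0
  g≡0 i ks<i = cong ℤ.∣_∣ (Good⇒deg≤ G (b + i) (ℕ.+-monoʳ-< b ks<i))
  sh-< : ∀ a f {d} → d < a → sh a f d ≡ 0ℤ
  sh-< (suc a) f {zero}  _         = refl
  sh-< (suc a) f {suc d} (s≤s d<a) = sh-< a f d<a
  nonneg : ∀ d → coeff p d ≡ + ℤ.∣ coeff p d ∣
  nonneg d with G d
  ... | a , p≡ , _ rewrite p≡ = refl
  coeff≡ : ∀ d → coeff p d ≡ sh b (λ i → + g i) d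
  coeff≡ d with b ℕ.≤? d
  ... | yes b≤d rewrite sym (ℕ.m+[n∸m]≡n b≤d) = trans (nonneg _) (sym (sh-at b _ (d ∸ b)))
  ... | no b≰d with G d
  ...   | a , p≡ , inj₁ refl = trans p≡ (sym (sh-< b _ (ℕ.≰⇒> b≰d)))
  ...   | a , p≡ , inj₂ (supp _ x _ refl _) = contradiction (ℕ.m≤m+n b x) b≰d

-- Chains in a staircase of grid points

module Staircase (n : ℕ) where

  -- For u = r - a and v = b - 1 with r = n + 1, the two inequalities are a ≤ b and a + b ≤ 2r.
  -- Reversing the left end turns inclusion into the componentwise order.
  Valid : ℕ → ℕ → Set
  Valid u v = n ≤ u + v × v ≤ n + u

  valid? : ∀ u v → Dec (Valid u v)
  valid? u v = n ≤? u + v ×-dec v ≤? n + u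

  -- R U V enumerates the weak chains of {(u, v) | Valid u v, u < U, v < V}, where (u, v) has
  -- rank u + v - n, by their top element.
  R : ℕ → ℕ → Arr
  R U V zero    d = δ d
  R U V (suc m) d =
    ∑< U λ u → ∑< V λ v → ι (does (valid? u v)) (sh (u + v ∸ n) (R (suc u) (suc v) m) d)

  -- Below a top element `(u, v)` any weak chain of the same rectangle may stand, so `T` removes
  -- exactly the chains with this top. The tops that remain are counted by inclusion-exclusion; the
  -- empty chain fits because 1 = 1 + 1 - 1.
  R-corner : ∀ {u v} → Valid u v →
             T (u + v ∸ n) (R (suc u) (suc v)) ≐ R u (suc v) +ᴬ R (suc u) v -ᴬ R u v
  R-corner uv zero d = lemma (δ d)
    where
    lemma : ∀ x → x ℤ.- 0ℤ ≡ x ℤ.+ x ℤ.- x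
    lemma = solve-∀
  R-corner {u} {v} uv (suc m) d = begin
    (r ℤ.+ (row ℤ.+ ι (does (valid? u v)) x)) ℤ.- x
      ≡⟨ cong (λ y → (r ℤ.+ (row ℤ.+ y)) ℤ.- x) (ι-yes (valid? u v) uv) ⟩
    (r ℤ.+ (row ℤ.+ x)) ℤ.- x
      ≡⟨ lemma r row x (R u v (suc m) d) ⟩
    r ℤ.+ (R u v (suc m) d ℤ.+ row) ℤ.- R u v (suc m) d ∎
    where
    open ≡-Reasoning
    r row x : ℤ
    r = R u (suc v) (suc m) d
    row = ∑< v λ v → ι (does (valid? u v)) (sh (u + v ∸ n) (R (suc u) (suc v) m) d)
    x = sh (u + v ∸ n) (R (suc u) (suc v) m) d
    lemma : ∀ r row x w → (r ℤ.+ (row ℤ.+ x)) ℤ.- x ≡ r ℤ.+ (w ℤ.+ row) ℤ.- w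
    lemma = solve-∀

  R-empty : ∀ {U V} → U + V ≤ suc n → R U V ≐ 1ᴬ
  R-empty         U+V≤1+n zero    d = refl
  R-empty {U} {V} U+V≤1+n (suc m) d = ∑<-zero U λ u u<U → ∑<-zero V λ v v<V →
    ι-no (valid? u v) λ (n≤u+v , _) → ℕ.<⇒≱ (u+v<n u<U v<V) n≤u+v
    where
    u+v<n : ∀ {u v} → u < U → v < V → u + v < n
    u+v<n {u} {v} u<U v<V = ℕ.s≤s⁻¹ (begin
      suc (suc (u + v)) ≡⟨ cong suc (ℕ.+-suc u v) ⟨
      suc u + suc v     ≤⟨ ℕ.+-mono-≤ u<U v<V ⟩
      U + V             ≤⟨ U+V≤1+n ⟩
      suc n             ∎)
      where open ℕ.≤-Reasoning

  -- Column `V` lies beyond the boundary `v ≤ n + u` for every row `u < U`.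
  R-column : ∀ {U V} → n + U ≤ V → R U (suc V) ≐ R U V
  R-column         n+U≤V zero    d = refl
  R-column {U} {V} n+U≤V (suc m) d = ∑<-cong U λ u u<U →
    trans (cong (ℤ._+_ (row u)) (ι-no (valid? u V) λ (_ , V≤n+u) →
             ℕ.<⇒≱ (ℕ.<-≤-trans (ℕ.+-monoʳ-< n u<U) n+U≤V) V≤n+u))
          (ℤ.+-identityʳ _)
    where
    row : ℕ → ℤ
    row u = ∑< V λ v → ι (does (valid? u v)) (sh (u + v ∸ n) (R (suc u) (suc v) m) d)

  Tⁿ-corner : ∀ {u v} L → Valid u v → u + v ≡ n + L →
              Tⁿ (suc L) (R (suc u) (suc v)) ≐ Tⁿ L (R u (suc v)) +ᴬ Tⁿ L (R (suc u) v) -ᴬ Tⁿ L (R u v)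
  Tⁿ-corner {u} {v} L uv u+v≡n+L =
    ≐-trans (Tⁿ-cong L (subst (λ a → T a (R (suc u) (suc v)) ≐ R u (suc v) +ᴬ R (suc u) v -ᴬ R u v)
                              rank≡L (R-corner uv)))
    (≐-trans (Tⁿ-sub L (R u (suc v) +ᴬ R (suc u) v) (R u v))
             λ m d → cong (ℤ._- Tⁿ L (R u v) m d) (Tⁿ-+ L (R u (suc v)) (R (suc u) v) m d))
    where
    rank≡L : u + v ∸ n ≡ L
    rank≡L = trans (cong (_∸ n) u+v≡n+L) (ℕ.m+n∸m≡n n L)

  -- The corner `(U - 1, V - 1)` stands for [a, b]: the equations say a + b + c = 2r and L = b - a +
  -- 1, and the bound on `U` says a ≥ 1. At `L = 0` the rectangle contains no root.
  Tⁿ-R≐N : ∀ L c U V → V + c ≡ n + U → U + V ≡ suc n + L → U ≤ suc n → Tⁿ L (R U V) ≐ N c L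
  Tⁿ-R≐N zero    c U V V+c≡ U+V≡ U≤ = R-empty (ℕ.≤-reflexive (trans U+V≡ (ℕ.+-identityʳ _)))
  Tⁿ-R≐N (suc L) c zero V V+c≡ U+V≡ U≤ = contradiction V≤n (ℕ.<⇒≱ n<V)
    where
    V≤n : V ≤ n
    V≤n = ℕ.≤-trans (ℕ.m≤m+n V c) (ℕ.≤-reflexive (trans V+c≡ (ℕ.+-identityʳ n)))
    n<V : n < V
    n<V = ℕ.≤-trans (ℕ.m≤m+n (suc n) (suc L)) (ℕ.≤-reflexive (sym U+V≡))
  Tⁿ-R≐N (suc L) c (suc u) zero V+c≡ U+V≡ U≤ = contradiction U≤ (ℕ.<⇒≱ (begin-strict
    suc n         <⟨ ℕ.m<m+n (suc n) (s≤s z≤n) ⟩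
    suc n + suc L ≡⟨ U+V≡ ⟨
    suc u + 0     ≡⟨ ℕ.+-identityʳ (suc u) ⟩
    suc u         ∎))
    where open ℕ.≤-Reasoning
  Tⁿ-R≐N (suc L) c (suc u) (suc v) V+c≡ U+V≡ U≤ =
    ≐-trans (Tⁿ-corner L uv u+v≡) (by-diagonal c v+c≡)
    where
    u+v≡ : u + v ≡ n + L
    u+v≡ = ℕ.suc-injective (ℕ.suc-injective (begin
      suc (suc (u + v)) ≡⟨ cong suc (ℕ.+-suc u v) ⟨
      suc u + suc v     ≡⟨ U+V≡ ⟩
      suc n + suc L     ≡⟨ cong suc (ℕ.+-suc n L) ⟩
      suc (suc (n + L)) ∎))
      where open ≡-Reasoning

    v+c≡ : v + c ≡ n + u
    v+c≡ = ℕ.suc-injective (trans V+c≡ (ℕ.+-suc n u))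

    uv : Valid u v
    uv = ℕ.≤-trans (ℕ.m≤m+n n L) (ℕ.≤-reflexive (sym u+v≡)) ,
         ℕ.≤-trans (ℕ.m≤m+n v c) (ℕ.≤-reflexive v+c≡)

    u≤ : u ≤ suc n
    u≤ = ℕ.≤-trans (ℕ.n≤1+n u) U≤

    left : ∀ c′ → v + c′ ≡ n + u → Tⁿ L (R (suc u) v) ≐ N (suc c′) L
    left c′ eq = Tⁿ-R≐N L (suc c′) (suc u) v
      (trans (ℕ.+-suc v c′) (trans (cong suc eq) (sym (ℕ.+-suc n u)))) (cong suc u+v≡) U≤

    by-diagonal : ∀ c → v + c ≡ n + u →
      Tⁿ L (R u (suc v)) +ᴬ Tⁿ L (R (suc u) v) -ᴬ Tⁿ L (R u v) ≐ N c (suc L)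
    -- On the diagonal [a+1, b] is no root: column `v` adds nothing to the rows below `u`, so this
    -- term cancels the meet.
    by-diagonal zero eq m d = begin
      Tⁿ L (R u (suc v)) m d ℤ.+ Tⁿ L (R (suc u) v) m d ℤ.- Tⁿ L (R u v) m d
        ≡⟨ cong (λ x → x ℤ.+ Tⁿ L (R (suc u) v) m d ℤ.- Tⁿ L (R u v) m d)
                (Tⁿ-cong L (R-column (ℕ.≤-reflexive (trans (sym eq) (ℕ.+-identityʳ v)))) m d) ⟩
      Tⁿ L (R u v) m d ℤ.+ Tⁿ L (R (suc u) v) m d ℤ.- Tⁿ L (R u v) m d
        ≡⟨ lemma (Tⁿ L (R u v) m d) _ ⟩
      Tⁿ L (R (suc u) v) m d ℤ.+ 0ℤ
        ≡⟨ cong (ℤ._+ 0ℤ) (left 0 eq m d) ⟩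
      N 1 L m d ℤ.+ 0ℤ ∎
      where
      open ≡-Reasoning
      lemma : ∀ x y → x ℤ.+ y ℤ.- x ≡ y ℤ.+ 0ℤ
      lemma = solve-∀
    by-diagonal (suc c) eq m d = begin
      Tⁿ L (R u (suc v)) m d ℤ.+ Tⁿ L (R (suc u) v) m d ℤ.- Tⁿ L (R u v) m d
        ≡⟨ cong₂ ℤ._-_ (cong₂ ℤ._+_ (below m d) (left (suc c) eq m d)) (corner L u+v≡ m d) ⟩
      N c L m d ℤ.+ N (suc (suc c)) L m d ℤ.- W L m d
        ≡⟨ recurrence L m d ⟩
      N (suc c) (suc L) m d ∎
      where
      open ≡-Reasoning

      below : Tⁿ L (R u (suc v)) ≐ N c L
      below = Tⁿ-R≐N L c u (suc v) (trans (sym (ℕ.+-suc v c)) eq)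
                (trans (ℕ.+-suc u v) (cong suc u+v≡)) u≤

      -- The meet has one rank fewer than `Tⁿ` provides for, so the last factor stays in front of
      -- its numerator. At `L = 0` the meet contains no root and there is no such factor.
      W : ℕ → Arr
      W zero    = 1ᴬ
      W (suc L) = T L (N (suc c) L)

      corner : ∀ L → u + v ≡ n + L → Tⁿ L (R u v) ≐ W L
      corner zero    u+v≡ = R-empty (ℕ.≤-trans (ℕ.≤-reflexive (trans u+v≡ (ℕ.+-identityʳ n))) (ℕ.n≤1+n n))
      corner (suc L) u+v≡ =
        ≐-trans (Tⁿ-T L L (R u v))
                (T-cong L (Tⁿ-R≐N L (suc c) u v eq (trans u+v≡ (ℕ.+-suc n L)) u≤))

      recurrence : ∀ L → N c L +ᴬ N (suc (suc c)) L -ᴬ W L ≐ N (suc c) (suc L)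
      recurrence zero    m d = lemma (1ᴬ m d)
        where
        lemma : ∀ x → x ℤ.+ x ℤ.- x ≡ x ℤ.+ 0ℤ
        lemma = solve-∀
      -- Unfolding `N c (suc L)` produces the numerator of the meet, which cancels; the `t`-part of
      -- the extra factor survives with a plus sign.
      recurrence (suc L) m d =
        lemma (N (suc c) L m d) (M c (suc L) m d) (N (suc (suc c)) (suc L) m d) (S L (N (suc c) L) m d)
        where
        lemma : ∀ x y z s → (x ℤ.+ y) ℤ.+ z ℤ.- (x ℤ.- s) ≡ z ℤ.+ (y ℤ.+ s)
        lemma = solve-∀

-- Weak chains of a finite poset, peeled off from the top

module Chains {X : Set} (P : List X) {_⊑_ : Rel X 0ℓ} (_⊑?_ : Decidable _⊑_) (ρ : X → ℕ) where

  open QZeta P _⊑?_ ρ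

  weight : List X → ℕ
  weight xs = sum (List.map ρ xs)

  linked : List X → Bool
  linked xs = does (linked? _⊑?_ xs)

  -- Weak chains of `m` elements under `x`. The recursion runs over top elements because ideals are
  -- what is known, whereas `tuples` adds elements at the bottom.
  B : ℕ → X → Seq
  B zero    x d = δ d
  B (suc m) x d = ∑ᴸ P λ y → ι (does (y ⊑? x)) (sh (ρ y) (B m y) d)

  -- Chains of length j + m + 1, cut at the element y in position j + 1.
  Z : ℕ → ℕ → Seq
  Z m j d = ∑ᴸ P λ y → ∑ᴸ (tuples m) λ ys → ι (linked (y ∷ ys)) (sh (weight (y ∷ ys)) (B j y) d)

  -- Moves the cut up by one element: after exchanging the sums, the condition and weight of the old
  -- cut element are exactly those in the definition of `B (suc j)`.
  Z-suc : ∀ m j → Z (suc m) j ≗ Z m (suc j)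
  Z-suc m j d = begin
    Z (suc m) j d
      ≡⟨ ∑ᴸ-cong P (λ y → ∑ᴸ-product _∷_ P (tuples m) (λ ys → ι (linked (y ∷ ys)) (sh (weight (y ∷ ys)) (B j y) d))) ⟩
    (∑ᴸ P λ y → ∑ᴸ P λ z → ∑ᴸ (tuples m) λ zs → term y z zs)
      ≡⟨ ∑ᴸ-swap P P (λ y z → ∑ᴸ (tuples m) λ zs → term y z zs) ⟩
    (∑ᴸ P λ z → ∑ᴸ P λ y → ∑ᴸ (tuples m) λ zs → term y z zs)
      ≡⟨ ∑ᴸ-cong P (λ z → ∑ᴸ-swap P (tuples m) (λ y zs → term y z zs)) ⟩
    (∑ᴸ P λ z → ∑ᴸ (tuples m) λ zs → ∑ᴸ P λ y → term y z zs)
      ≡⟨ ∑ᴸ-cong P (λ z → ∑ᴸ-cong (tuples m) (λ zs → absorb z zs)) ⟩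
    Z m (suc j) d ∎
    where
    open ≡-Reasoning
    term : X → X → List X → ℤ
    term y z zs = ι (linked (y ∷ z ∷ zs)) (sh (weight (y ∷ z ∷ zs)) (B j y) d)

    absorb : ∀ z zs → ∑ᴸ P (λ y → term y z zs) ≡ ι (linked (z ∷ zs)) (sh (weight (z ∷ zs)) (B (suc j) z) d)
    absorb z zs = begin
      ∑ᴸ P (λ y → term y z zs)
        ≡⟨ ∑ᴸ-cong P (λ y → trans (ι-∧ (does (y ⊑? z)) (linked (z ∷ zs)) _)
             (cong (ι (linked (z ∷ zs)) ∘ ι (does (y ⊑? z)))
               (trans (cong (λ w → sh w (B j y) d) (ℕ.+-comm (ρ y) (weight (z ∷ zs))))
                      (sym (sh-sh (weight (z ∷ zs)) (ρ y) (B j y) d))))) ⟩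
      ∑ᴸ P (λ y → ι (linked (z ∷ zs)) (ι (does (y ⊑? z)) (sh (weight (z ∷ zs)) (sh (ρ y) (B j y)) d)))
        ≡⟨ ∑ᴸ-ι P (linked (z ∷ zs)) _ ⟩
      ι (linked (z ∷ zs)) (∑ᴸ P (λ y → ι (does (y ⊑? z)) (sh (weight (z ∷ zs)) (sh (ρ y) (B j y)) d)))
        ≡⟨ cong (ι (linked (z ∷ zs))) (∑ᴸ-cong P (λ y → sh-ι (weight (z ∷ zs)) (does (y ⊑? z)) (sh (ρ y) (B j y)) d)) ⟨
      ι (linked (z ∷ zs)) (∑ᴸ P (λ y → sh (weight (z ∷ zs)) (λ d → ι (does (y ⊑? z)) (sh (ρ y) (B j y) d)) d))
        ≡⟨ cong (ι (linked (z ∷ zs))) (sh-∑ᴸ (weight (z ∷ zs)) P (λ y d → ι (does (y ⊑? z)) (sh (ρ y) (B j y) d)) d) ⟨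
      ι (linked (z ∷ zs)) (sh (weight (z ∷ zs)) (B (suc j) z) d) ∎

  Z-0 : ∀ m j → Z m j ≗ Z 0 (j + m)
  Z-0 zero    j d rewrite ℕ.+-identityʳ j = refl
  Z-0 (suc m) j d rewrite ℕ.+-suc j m = trans (Z-suc m j d) (Z-0 m (suc j) d)

  coeff-A : ∀ m d → coeff (A m) d ≡ ∑ᴸ (tuples m) (λ xs → ι (linked xs) (sh (weight xs) δ d))
  coeff-A m d = begin
    coeff (A m) d
      ≡⟨ coeff-∑ (λ xs → q^ weight xs) (weakChains m) d ⟩
    ∑ᴸ (weakChains m) (λ xs → coeff (q^ weight xs) d)
      ≡⟨ ∑ᴸ-filter (linked? _⊑?_) (tuples m) _ ⟩
    ∑ᴸ (tuples m) (λ xs → ι (linked xs) (coeff (q^ weight xs) d))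
      ≡⟨ ∑ᴸ-cong (tuples m) (λ xs → cong (ι (linked xs)) (coeff-q^ (weight xs) d)) ⟩
    ∑ᴸ (tuples m) (λ xs → ι (linked xs) (sh (weight xs) δ d)) ∎
    where open ≡-Reasoning

  coeff-A-0 : ∀ d → coeff (A 0) d ≡ δ d
  coeff-A-0 d = trans (coeff-A 0 d) (ℤ.+-identityʳ _)

  -- The cut slides from the bottom element, where `Z` enumerates the listed chains, to the top
  -- element, where only `B` is left.
  coeff-A-suc : ∀ m d → coeff (A (suc m)) d ≡ ∑ᴸ P (λ y → sh (ρ y) (B m y) d)
  coeff-A-suc m d = begin
    coeff (A (suc m)) d
      ≡⟨ coeff-A (suc m) d ⟩
    ∑ᴸ (tuples (suc m)) (λ xs → ι (linked xs) (sh (weight xs) δ d))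
      ≡⟨ ∑ᴸ-product _∷_ P (tuples m) _ ⟩
    (∑ᴸ P λ y → ∑ᴸ (tuples m) λ ys → ι (linked (y ∷ ys)) (sh (weight (y ∷ ys)) δ d))
      ≡⟨ ∑ᴸ-cong P (λ y → ∑ᴸ-cong (tuples m) λ ys → cong (ι (linked (y ∷ ys))) (sh-cong (weight (y ∷ ys)) (λ _ → refl) d)) ⟩
    Z m 0 d
      ≡⟨ Z-0 m 0 d ⟩
    Z 0 m d
      ≡⟨ ∑ᴸ-cong P (λ y → trans (ℤ.+-identityʳ _) (cong (λ w → sh w (B m y) d) (ℕ.+-identityʳ (ρ y)))) ⟩
    ∑ᴸ P (λ y → sh (ρ y) (B m y) d) ∎
    where open ≡-Reasoning

-- The positive roots of B_r as grid points

basis : ∀ r → ℕ → Vec ℤ r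
basis zero    _       = []
basis (suc r) zero    = 1ℤ ∷ 0ᵛ
basis (suc r) (suc i) = 0ℤ ∷ basis r i

e≡basis : ∀ {r} (i : Fin r) → e i ≡ basis r (toℕ i)
e≡basis Fin.zero    = refl
e≡basis (Fin.suc i) = cong (0ℤ ∷_) (e≡basis i)

-- Makes the short root e_i the boundary case e_i + 0 of the family e_i + e_j.
basis-outside : ∀ r → basis r r ≡ 0ᵛ
basis-outside zero    = refl
basis-outside (suc r) = cong (0ℤ ∷_) (basis-outside r)

partialSum : ∀ {r} → Vec ℤ r → ℕ → ℤ
partialSum []      p       = 0ℤ
partialSum (x ∷ v) zero    = x
partialSum (x ∷ v) (suc p) = x ℤ.+ partialSum v p

lookup-coefficients : ∀ {r} (v : Vec ℤ r) p → Vec.lookup (coefficients v) p ≡ partialSum v (toℕ p)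
lookup-coefficients (x ∷ [])    Fin.zero    = refl
lookup-coefficients (x ∷ y ∷ v) Fin.zero    = refl
lookup-coefficients (x ∷ y ∷ v) (Fin.suc p) =
  trans (lookup-coefficients ((x ℤ.+ y) ∷ v) p) (merge (toℕ p))
  where
  merge : ∀ p → partialSum ((x ℤ.+ y) ∷ v) p ≡ x ℤ.+ partialSum (y ∷ v) p
  merge zero    = refl
  merge (suc p) = ℤ.+-assoc x y _

partialSum-+ᵛ : ∀ {r} (v w : Vec ℤ r) p → partialSum (v +ᵛ w) p ≡ partialSum v p ℤ.+ partialSum w p
partialSum-+ᵛ []      []      p       = refl
partialSum-+ᵛ (x ∷ v) (y ∷ w) zero    = refl
partialSum-+ᵛ (x ∷ v) (y ∷ w) (suc p) =
  trans (cong (ℤ._+_ (x ℤ.+ y)) (partialSum-+ᵛ v w p))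
        (interchange x y (partialSum v p) (partialSum w p))

partialSum-subᵛ : ∀ {r} (v w : Vec ℤ r) p → partialSum (v -ᵛ w) p ≡ partialSum v p ℤ.- partialSum w p
partialSum-subᵛ []      []      p       = refl
partialSum-subᵛ (x ∷ v) (y ∷ w) zero    = refl
partialSum-subᵛ (x ∷ v) (y ∷ w) (suc p) =
  trans (cong (ℤ._+_ (x ℤ.- y)) (partialSum-subᵛ v w p))
        (lemma x y (partialSum v p) (partialSum w p))
  where
  lemma : ∀ x y z w → (x ℤ.- y) ℤ.+ (z ℤ.- w) ≡ (x ℤ.+ z) ℤ.- (y ℤ.+ w)
  lemma = solve-∀

step : ℕ → ℕ → ℤ
step i p = ι (does (i ≤? p)) 1ℤ

partialSum-0ᵛ : ∀ r p → partialSum (0ᵛ {r}) p ≡ 0ℤ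
partialSum-0ᵛ zero    p       = refl
partialSum-0ᵛ (suc r) zero    = refl
partialSum-0ᵛ (suc r) (suc p) = trans (ℤ.+-identityˡ _) (partialSum-0ᵛ r p)

step-suc : ∀ i p → step (suc i) (suc p) ≡ step i p
step-suc i p = cong (λ b → ι b 1ℤ) (does-⇔ (mk⇔ ℕ.s≤s⁻¹ s≤s) (suc i ≤? suc p) (i ≤? p))

partialSum-basis : ∀ {r} i p → p < r → partialSum (basis r i) p ≡ step i p
partialSum-basis {suc r} zero    zero    p<r       = refl
partialSum-basis {suc r} zero    (suc p) p<r       = cong (ℤ._+_ 1ℤ) (partialSum-0ᵛ r p)
partialSum-basis {suc r} (suc i) zero    p<r       = refl
partialSum-basis {suc r} (suc i) (suc p) (s≤s p<r) =
  trans (ℤ.+-identityˡ _) (trans (partialSum-basis i p p<r) (sym (step-suc i p)))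

step≡1 : ∀ {i p} → i ≤ p → step i p ≡ 1ℤ
step≡1 i≤p = ι-yes (_ ≤? _) i≤p

step≡0 : ∀ {i p} → p < i → step i p ≡ 0ℤ
step≡0 p<i = ι-no (_ ≤? _) (ℕ.<⇒≱ p<i)

0≤step : ∀ i p → 0ℤ ℤ.≤ step i p
0≤step i p with does (i ≤? p)
... | true  = ℤ.+≤+ z≤n
... | false = ℤ.≤-refl

step≤1 : ∀ i p → step i p ℤ.≤ 1ℤ
step≤1 i p with does (i ≤? p)
... | true  = ℤ.≤-refl
... | false = ℤ.+≤+ z≤n

step-antitone : ∀ {i j} p → i ≤ j → step j p ℤ.≤ step i p
step-antitone {i} {j} p i≤j with ℕ.≤-total j p
... | inj₁ j≤p rewrite step≡1 (ℕ.≤-trans i≤j j≤p) = step≤1 j p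
... | inj₂ p≤j with ℕ.m≤n⇒m<n∨m≡n p≤j
...   | inj₁ p<j rewrite step≡0 p<j = 0≤step i p
...   | inj₂ refl rewrite step≡1 i≤j = step≤1 j p

∑-step : ∀ r i → ∑< r (step i) ≡ + (r ∸ i)
∑-step zero    i rewrite ℕ.0∸n≡0 i = refl
∑-step (suc r) i with i ≤? r
... | yes i≤r rewrite ∑-step r i | step≡1 i≤r = begin
  + (r ∸ i + 1)   ≡⟨ cong +_ (ℕ.+-comm (r ∸ i) 1) ⟩
  + suc (r ∸ i)   ≡⟨ cong +_ (ℕ.+-∸-assoc 1 i≤r) ⟨
  + (suc r ∸ i)   ∎
  where open ≡-Reasoning
... | no i≰r rewrite ∑-step r i | step≡0 (ℕ.≰⇒> i≰r) =
  cong +_ (trans (ℕ.+-identityʳ _) (trans (ℕ.m≤n⇒m∸n≡0 (ℕ.<⇒≤ (ℕ.≰⇒> i≰r)))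
                                          (sym (ℕ.m≤n⇒m∸n≡0 (ℕ.≰⇒> i≰r)))))

ht≡∑ : ∀ {r} (v : Vec ℤ r) → ht v ≡ ∑< r (partialSum v)
ht≡∑ v = foldr≡∑ (coefficients v) (partialSum v) (lookup-coefficients v)
  where
  foldr≡∑ : ∀ {r} (w : Vec ℤ r) f → (∀ p → Vec.lookup w p ≡ f (toℕ p)) →
            Vec.foldr′ ℤ._+_ 0ℤ w ≡ ∑< r f
  foldr≡∑ []      f w≡f = refl
  foldr≡∑ {suc r} (x ∷ w) f w≡f =
    trans (cong₂ ℤ._+_ (w≡f Fin.zero) (foldr≡∑ w (f ∘ suc) (w≡f ∘ Fin.suc)))
          (sym (∑<-suc r f))

-- The simple roots form a lattice basis, so the only candidate coefficients are differences of
-- partial sums, and these are natural numbers exactly when nonnegative.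
≼⇔partialSum≤ : ∀ {r} (α β : Vec ℤ r) →
  (α ≼ β → ∀ p → p < r → partialSum α p ℤ.≤ partialSum β p) ×
  ((∀ p → p < r → partialSum α p ℤ.≤ partialSum β p) → α ≼ β)
≼⇔partialSum≤ {r} α β = to , from
  where
  to : α ≼ β → ∀ p → p < r → partialSum α p ℤ.≤ partialSum β p
  to (c , c≡) p p<r = ℤ.0≤i-j⇒j≤i (subst (0ℤ ℤ.≤_) difference (ℤ.+≤+ z≤n))
    where
    open ≡-Reasoning
    i : Fin r
    i = Fin.fromℕ< p<r
    difference : + Vec.lookup c i ≡ partialSum β p ℤ.- partialSum α p
    difference = begin
      + Vec.lookup c i                                        ≡⟨ Vec.lookup-map i +_ c ⟨
      Vec.lookup (Vec.map +_ c) i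
        ≡⟨ cong (λ w → Vec.lookup w i) (coefficients-combination (Vec.map +_ c)) ⟨
      Vec.lookup (coefficients (combination (Vec.map +_ c))) i
        ≡⟨ cong (λ w → Vec.lookup (coefficients w) i) c≡ ⟩
      Vec.lookup (coefficients (β -ᵛ α)) i                    ≡⟨ lookup-coefficients (β -ᵛ α) i ⟩
      partialSum (β -ᵛ α) (toℕ i)                             ≡⟨ cong (partialSum (β -ᵛ α)) (Fin.toℕ-fromℕ< p<r) ⟩
      partialSum (β -ᵛ α) p                                   ≡⟨ partialSum-subᵛ β α p ⟩
      partialSum β p ℤ.- partialSum α p                       ∎

  map-+∣_∣ : ∀ {r} (w : Vec ℤ r) → (∀ p → 0ℤ ℤ.≤ Vec.lookup w p) → Vec.map +_ (Vec.map ℤ.∣_∣ w) ≡ w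
  map-+∣ []    ∣ 0≤ = refl
  map-+∣ x ∷ w ∣ 0≤ = cong₂ _∷_ (ℤ.0≤i⇒+∣i∣≡i (0≤ Fin.zero)) (map-+∣ w ∣ (0≤ ∘ Fin.suc))

  from : (∀ p → p < r → partialSum α p ℤ.≤ partialSum β p) → α ≼ β
  from α≤β = Vec.map ℤ.∣_∣ (coefficients (β -ᵛ α)) ,
    trans (cong combination (map-+∣ coefficients (β -ᵛ α) ∣ λ p →
             subst (0ℤ ℤ.≤_) (sym (trans (lookup-coefficients (β -ᵛ α) p) (partialSum-subᵛ β α (toℕ p))))
                   (ℤ.i≤j⇒0≤j-i (α≤β (toℕ p) (Fin.toℕ<n p)))))
          (combination-coefficients (β -ᵛ α))

-- Height and order of roots in interval coordinates

module Roots (n : ℕ) where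

  -- In the paper's 1-based indexing: e_{i+1} - e_{v+2} for v < n, e_{i+1} for v = n,
  -- and e_{i+1} + e_{2n+2-v} for v > n.  Row i consists of the v with i ≤ v ≤ 2n - i.
  root : ℕ → ℕ → Vec ℤ (suc n)
  root i v = if does (v <? n) then basis (suc n) i -ᵛ basis (suc n) (suc v)
                              else basis (suc n) i +ᵛ basis (suc n) (suc (n + n) ∸ v)

  root-< : ∀ i {v} → v < n → root i v ≡ basis (suc n) i -ᵛ basis (suc n) (suc v)
  root-< i {v} v<n rewrite dec-true (v <? n) v<n = refl

  root-≥ : ∀ i {v} → n ≤ v → root i v ≡ basis (suc n) i +ᵛ basis (suc n) (suc (n + n) ∸ v)
  root-≥ i {v} n≤v rewrite dec-false (v <? n) (ℕ.≤⇒≯ n≤v) = refl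

  root-n : ∀ i → root i n ≡ basis (suc n) i
  root-n i = begin
    root i n                                              ≡⟨ root-≥ i ℕ.≤-refl ⟩
    basis (suc n) i +ᵛ basis (suc n) (suc n + n ∸ n)      ≡⟨ cong (λ j → basis (suc n) i +ᵛ basis (suc n) j) (ℕ.m+n∸n≡m (suc n) n) ⟩
    basis (suc n) i +ᵛ basis (suc n) (suc n)              ≡⟨ cong (basis (suc n) i +ᵛ_) (basis-outside (suc n)) ⟩
    basis (suc n) i +ᵛ 0ᵛ                                 ≡⟨ Vec.zipWith-identityʳ ℤ.+-identityʳ (basis (suc n) i) ⟩
    basis (suc n) i                                       ∎
    where open ≡-Reasoning

  partialSum-root-< : ∀ i {v p} → p ≤ n → v < n → partialSum (root i v) p ≡ step i p ℤ.- step (suc v) p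
  partialSum-root-< i {v} {p} p≤n v<n rewrite root-< i v<n =
    trans (partialSum-subᵛ (basis (suc n) i) (basis (suc n) (suc v)) p)
          (cong₂ ℤ._-_ (partialSum-basis i p (s≤s p≤n)) (partialSum-basis (suc v) p (s≤s p≤n)))

  partialSum-root-≥ : ∀ i {v p} → p ≤ n → n ≤ v → partialSum (root i v) p ≡ step i p ℤ.+ step (suc (n + n) ∸ v) p
  partialSum-root-≥ i {v} {p} p≤n n≤v rewrite root-≥ i n≤v =
    trans (partialSum-+ᵛ (basis (suc n) i) (basis (suc n) (suc (n + n) ∸ v)) p)
          (cong₂ ℤ._+_ (partialSum-basis i p (s≤s p≤n)) (partialSum-basis (suc (n + n) ∸ v) p (s≤s p≤n)))

  InRow : ℕ → ℕ → Set
  InRow i v = i ≤ v × v + i ≤ n + n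

  inRow? : ∀ i v → Dec (InRow i v)
  inRow? i v = i ≤? v ×-dec v + i ≤? n + n

  reflected : ∀ {i v} → InRow i v → i < suc (n + n) ∸ v
  reflected {i} {v} (_ , v+i≤2n) = ℕ.m+n≤o⇒m≤o∸n (suc i) (s≤s (subst (_≤ n + n) (ℕ.+-comm v i) v+i≤2n))

  -- By `∑-step` the 0-based e_i has height n + 1 - i. Both families then give the length of the
  -- interval: the second index is v + 1 in the difference and 2n + 1 - v in the sum.
  ht-root : ∀ {i v} → i ≤ n → InRow i v → ht (root i v) ≡ + suc (v ∸ i)
  ht-root {i} {v} i≤n (i≤v , v+i≤2n) with v <? n
  ... | yes v<n = begin
    ht (root i v)
      ≡⟨ ht≡∑ (root i v) ⟩
    ∑< (suc n) (partialSum (root i v))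
      ≡⟨ ∑<-cong (suc n) (λ p p<r → partialSum-root-< i (ℕ.s≤s⁻¹ p<r) v<n) ⟩
    ∑< (suc n) (λ p → step i p ℤ.- step (suc v) p)
      ≡⟨ ∑<-sub (suc n) (step i) (step (suc v)) ⟩
    ∑< (suc n) (step i) ℤ.- ∑< (suc n) (step (suc v))
      ≡⟨ cong₂ ℤ._-_ (∑-step (suc n) i) (∑-step (suc n) (suc v)) ⟩
    + (suc n ∸ i) ℤ.- + (n ∸ v)
      ≡⟨ cong (λ x → + x ℤ.- + (n ∸ v)) split ⟩
    + (suc (v ∸ i) + (n ∸ v)) ℤ.- + (n ∸ v)
      ≡⟨ lemma (+ suc (v ∸ i)) (+ (n ∸ v)) ⟩
    + suc (v ∸ i) ∎
    where
    open ≡-Reasoning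
    split : suc n ∸ i ≡ suc (v ∸ i) + (n ∸ v)
    split = trans (ℕ.+-∸-assoc 1 i≤n) (cong suc (begin
      n ∸ i               ≡⟨ cong (_∸ i) (ℕ.m+[n∸m]≡n (ℕ.<⇒≤ v<n)) ⟨
      v + (n ∸ v) ∸ i     ≡⟨ ℕ.+-∸-comm (n ∸ v) i≤v ⟩
      v ∸ i + (n ∸ v)     ∎))
    lemma : ∀ x y → (x ℤ.+ y) ℤ.- y ≡ x
    lemma = solve-∀
  ... | no v≮n = begin
    ht (root i v)
      ≡⟨ ht≡∑ (root i v) ⟩
    ∑< (suc n) (partialSum (root i v))
      ≡⟨ ∑<-cong (suc n) (λ p p<r → partialSum-root-≥ i (ℕ.s≤s⁻¹ p<r) n≤v) ⟩
    ∑< (suc n) (λ p → step i p ℤ.+ step (suc (n + n) ∸ v) p)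
      ≡⟨ ∑<-+ (suc n) (step i) (step (suc (n + n) ∸ v)) ⟩
    ∑< (suc n) (step i) ℤ.+ ∑< (suc n) (step (suc (n + n) ∸ v))
      ≡⟨ cong₂ ℤ._+_ (∑-step (suc n) i) (∑-step (suc n) (suc (n + n) ∸ v)) ⟩
    + (suc n ∸ i + (suc n ∸ (suc (n + n) ∸ v)))
      ≡⟨ cong (λ x → + (suc n ∸ i + x)) reflect ⟩
    + (suc n ∸ i + (v ∸ n))
      ≡⟨ cong +_ join ⟩
    + suc (v ∸ i) ∎
    where
    open ≡-Reasoning
    n≤v : n ≤ v
    n≤v = ℕ.≮⇒≥ v≮n
    v∸n≤1+n : v ∸ n ≤ suc n
    v∸n≤1+n = ℕ.m≤n⇒m≤1+n (ℕ.m≤n+o⇒m∸n≤o v n (ℕ.m+n≤o⇒m≤o v v+i≤2n))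
    reflect : suc n ∸ (suc (n + n) ∸ v) ≡ v ∸ n
    reflect = begin
      suc n ∸ (suc (n + n) ∸ v)              ≡⟨ cong (λ x → suc n ∸ (suc (n + n) ∸ x)) (ℕ.m+[n∸m]≡n n≤v) ⟨
      suc n ∸ (suc (n + n) ∸ (n + (v ∸ n)))  ≡⟨ cong (suc n ∸_) (ℕ.∸-+-assoc (suc (n + n)) n (v ∸ n)) ⟨
      suc n ∸ (suc n + n ∸ n ∸ (v ∸ n))      ≡⟨ cong (λ x → suc n ∸ (x ∸ (v ∸ n))) (ℕ.m+n∸n≡m (suc n) n) ⟩
      suc n ∸ (suc n ∸ (v ∸ n))              ≡⟨ ℕ.m∸[m∸n]≡n v∸n≤1+n ⟩
      v ∸ n                                  ∎
    join : suc n ∸ i + (v ∸ n) ≡ suc (v ∸ i)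
    join = begin
      suc n ∸ i + (v ∸ n)     ≡⟨ ℕ.+-∸-comm (v ∸ n) (ℕ.m≤n⇒m≤1+n i≤n) ⟨
      suc n + (v ∸ n) ∸ i     ≡⟨ cong (λ x → suc x ∸ i) (ℕ.m+[n∸m]≡n n≤v) ⟩
      suc v ∸ i               ≡⟨ ℕ.+-∸-assoc 1 i≤v ⟩
      suc (v ∸ i)             ∎

  rk-root : ∀ {i v} → i ≤ n → InRow i v → rk (root i v) ≡ v ∸ i
  rk-root i≤n iv rewrite ht-root i≤n iv = refl

  partialSum-mono : ∀ {i v i′ v′} p → p ≤ n → i′ ≤ i → v ≤ v′ →
                    partialSum (root i v) p ℤ.≤ partialSum (root i′ v′) p
  partialSum-mono {i} {v} {i′} {v′} p p≤n i′≤i v≤v′ with v <? n | v′ <? n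
  ... | yes v<n | yes v′<n rewrite partialSum-root-< i p≤n v<n | partialSum-root-< i′ p≤n v′<n =
    ℤ.+-mono-≤ (step-antitone p i′≤i) (ℤ.neg-mono-≤ (step-antitone p (s≤s v≤v′)))
  ... | yes v<n | no v′≮n rewrite partialSum-root-< i p≤n v<n | partialSum-root-≥ i′ p≤n (ℕ.≮⇒≥ v′≮n) =
    ℤ.+-mono-≤ (step-antitone p i′≤i) (ℤ.≤-trans (ℤ.neg-mono-≤ (0≤step (suc v) p)) (0≤step (suc (n + n) ∸ v′) p))
  ... | no v≮n | yes v′<n = contradiction (ℕ.≤-<-trans v≤v′ v′<n) v≮n
  ... | no v≮n | no v′≮n rewrite partialSum-root-≥ i p≤n (ℕ.≮⇒≥ v≮n) | partialSum-root-≥ i′ p≤n (ℕ.≮⇒≥ v′≮n) =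
    ℤ.+-mono-≤ (step-antitone p i′≤i) (step-antitone p (ℕ.∸-monoʳ-≤ (suc (n + n)) v≤v′))

  -- This bound and the next two locate the simple roots that occur in `root i v`; a false
  -- comparison is refuted at a single `p`.
  partialSum-inside : ∀ {i v p} → i ≤ p → p ≤ v → p ≤ n → 1ℤ ℤ.≤ partialSum (root i v) p
  partialSum-inside {i} {v} {p} i≤p p≤v p≤n with v <? n
  ... | yes v<n rewrite partialSum-root-< i p≤n v<n | step≡1 i≤p | step≡0 (s≤s p≤v) = ℤ.≤-refl
  ... | no v≮n rewrite partialSum-root-≥ i p≤n (ℕ.≮⇒≥ v≮n) | step≡1 i≤p =
    ℤ.+-monoʳ-≤ 1ℤ (0≤step (suc (n + n) ∸ v) p)

  partialSum-before : ∀ {i v p} → InRow i v → p < i → p ≤ n → partialSum (root i v) p ℤ.≤ 0ℤ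
  partialSum-before {i} {v} {p} iv p<i p≤n with v <? n
  ... | yes v<n rewrite partialSum-root-< i p≤n v<n | step≡0 p<i =
    subst (ℤ._≤ 0ℤ) (sym (ℤ.+-identityˡ _)) (ℤ.neg-mono-≤ (0≤step (suc v) p))
  ... | no v≮n rewrite partialSum-root-≥ i p≤n (ℕ.≮⇒≥ v≮n) | step≡0 p<i
                     | step≡0 (ℕ.<-trans p<i (reflected iv)) = ℤ.≤-refl

  partialSum-after : ∀ i {v p} → v < p → p ≤ n → partialSum (root i v) p ℤ.≤ 0ℤ
  partialSum-after i {v} {p} v<p p≤n
    rewrite partialSum-root-< i p≤n (ℕ.<-≤-trans v<p p≤n) | step≡1 v<p =
    ℤ.+-monoˡ-≤ (ℤ.- 1ℤ) (step≤1 i p)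

  1≰0 : ¬ 1ℤ ℤ.≤ 0ℤ
  1≰0 (ℤ.+≤+ ())

  2≰1 : ¬ + 2 ℤ.≤ 1ℤ
  2≰1 (ℤ.+≤+ (s≤s ()))

  partialSum≤⇒i≥ : ∀ {i v i′ v′} → i ≤ n → InRow i v → InRow i′ v′ →
    (∀ p → p < suc n → partialSum (root i v) p ℤ.≤ partialSum (root i′ v′) p) → i′ ≤ i
  partialSum≤⇒i≥ i≤n (i≤v , _) iv′ ≤′ = ℕ.≮⇒≥ λ i<i′ → 1≰0
    (ℤ.≤-trans (partialSum-inside ℕ.≤-refl i≤v i≤n)
    (ℤ.≤-trans (≤′ _ (s≤s i≤n)) (partialSum-before iv′ i<i′ i≤n)))

  partialSum≤⇒v≤ : ∀ {i v i′ v′} → i ≤ n → InRow i v →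
    (∀ p → p < suc n → partialSum (root i v) p ℤ.≤ partialSum (root i′ v′) p) → v ≤ v′
  partialSum≤⇒v≤ {i} {v} {i′} {v′} i≤n iv@(i≤v , v+i≤2n) ≤′ = ℕ.≮⇒≥ v′≮v
    where
    v′≮v : ¬ v′ < v
    v′≮v v′<v with v′ <? n
    -- The index tested must lie beyond `v′` but still in the support of the left root; the maximum
    -- with `i` covers the case that this support starts after `v′ + 1`.
    ... | yes v′<n = 1≰0
      (ℤ.≤-trans (partialSum-inside (ℕ.m≤m⊔n i (suc v′)) (ℕ.⊔-lub i≤v v′<v) p≤n)
      (ℤ.≤-trans (≤′ _ (s≤s p≤n)) (partialSum-after i′ (ℕ.m≤n⊔m i (suc v′)) p≤n)))
      where
      p≤n : i ℕ.⊔ suc v′ ≤ n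
      p≤n = ℕ.⊔-lub i≤n v′<n
    -- Both roots may now involve all late simple roots, so multiplicities must decide: at the
    -- second index of the left root its coefficient is 2, while the right root, with a larger
    -- second index, has at most 1.
    ... | no v′≮n = 2≰1 (ℤ.≤-trans (subst₂ ℤ._≤_ two one (≤′ p (s≤s p≤n))) (step≤1 i′ p))
      where
      n≤v′ : n ≤ v′
      n≤v′ = ℕ.≮⇒≥ v′≮n
      n<v : n < v
      n<v = ℕ.≤-<-trans n≤v′ v′<v
      p : ℕ
      p = suc (n + n) ∸ v
      p≤n : p ≤ n
      p≤n = ℕ.m≤n+o⇒m∸n≤o (suc (n + n)) v (ℕ.+-monoˡ-≤ n n<v)
      two : partialSum (root i v) p ≡ + 2
      two rewrite partialSum-root-≥ i p≤n (ℕ.<⇒≤ n<v) | step≡1 (ℕ.<⇒≤ (reflected iv)) | step≡1 (ℕ.≤-refl {p}) = refl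
      one : partialSum (root i′ v′) p ≡ step i′ p
      one rewrite partialSum-root-≥ i′ p≤n n≤v′
                | step≡0 (ℕ.∸-monoʳ-< v′<v (ℕ.m≤n⇒m≤1+n (ℕ.m+n≤o⇒m≤o v v+i≤2n))) = ℤ.+-identityʳ _

-- The chain series of B_r on the staircase

module Numerator (n : ℕ) where

  open Roots n
  open Staircase n
  open QZeta (positiveRoots (suc n)) _≼?_ rk using (A; maxRank)
  open Chains (positiveRoots (suc n)) _≼?_ rk using (B; coeff-A-0; coeff-A-suc)

  Valid⇒InRow : ∀ {u v} → u ≤ n → Valid u v → InRow (n ∸ u) v
  Valid⇒InRow {u} {v} u≤n (n≤u+v , v≤n+u) = ℕ.m≤n+o⇒m∸n≤o n u n≤u+v , (begin
    v + (n ∸ u)       ≤⟨ ℕ.+-monoˡ-≤ (n ∸ u) v≤n+u ⟩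
    n + u + (n ∸ u)   ≡⟨ ℕ.+-assoc n u (n ∸ u) ⟩
    n + (u + (n ∸ u)) ≡⟨ cong (_+_ n) (ℕ.m+[n∸m]≡n u≤n) ⟩
    n + n             ∎)
    where open ℕ.≤-Reasoning

  InRow⇒Valid : ∀ {u v} → InRow (n ∸ u) v → Valid u v
  InRow⇒Valid {u} {v} (n∸u≤v , v+[n∸u]≤2n) =
    ℕ.≤-trans (ℕ.m≤n+m∸n n u) (ℕ.+-monoʳ-≤ u n∸u≤v) , ℕ.+-cancelʳ-≤ n v (n + u) (begin
      v + n             ≤⟨ ℕ.+-monoʳ-≤ v (ℕ.m≤n+m∸n n u) ⟩
      v + (u + (n ∸ u)) ≡⟨ lemma v u (n ∸ u) ⟩
      v + (n ∸ u) + u   ≤⟨ ℕ.+-monoˡ-≤ u v+[n∸u]≤2n ⟩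
      n + n + u         ≡⟨ trans (ℕ.+-assoc n n u) (lemma n n u) ⟩
      n + u + n         ∎)
    where
    open ℕ.≤-Reasoning
    lemma : ∀ a b c → a + (b + c) ≡ a + c + b
    lemma = ℕ-Ring.solve-∀

  row : (Vec ℤ (suc n) → ℤ) → ℕ → ℤ
  row f i = ∑< (suc (n + n)) λ v → ι (does (inRow? i v)) (f (root i v))

  -- The roots starting at `i`, in order of height: e_i - e_j with j increasing, then e_i, then e_i
  -- + e_j with j decreasing.
  row-split : ∀ f i → i ≤ n →
    ∑< (suc n) (λ j → ι (does (i <? j)) (f (basis (suc n) i -ᵛ basis (suc n) j))) ℤ.+
    (f (basis (suc n) i) ℤ.+
     ∑< (suc n) (λ j → ι (does (i <? j)) (f (basis (suc n) i +ᵛ basis (suc n) j))))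
    ≡ row f i
  row-split f i i≤n = begin
    ∑< (suc n) short ℤ.+ (f (basis (suc n) i) ℤ.+ ∑< (suc n) long)
      ≡⟨ cong₂ ℤ._+_ (from-1 λ j → f (basis (suc n) i -ᵛ basis (suc n) j)) (cong₂ ℤ._+_ middle (from-1 λ j → f (basis (suc n) i +ᵛ basis (suc n) j))) ⟩
    ∑< n (short ∘ suc) ℤ.+ (G n ℤ.+ ∑< n (long ∘ suc))
      ≡⟨ ℤ.+-assoc (∑< n (short ∘ suc)) (G n) _ ⟨
    ∑< n (short ∘ suc) ℤ.+ G n ℤ.+ ∑< n (long ∘ suc)
      ≡⟨ cong₂ ℤ._+_ (cong (ℤ._+ G n) (∑<-cong n short≡)) long≡ ⟩
    ∑< (suc n) G ℤ.+ ∑< n (λ w → G (suc n + w))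
      ≡⟨ ∑<-++ (suc n) n G ⟨
    row f i ∎
    where
    open ≡-Reasoning
    short long G : ℕ → ℤ
    short j = ι (does (i <? j)) (f (basis (suc n) i -ᵛ basis (suc n) j))
    long  j = ι (does (i <? j)) (f (basis (suc n) i +ᵛ basis (suc n) j))
    G v = ι (does (inRow? i v)) (f (root i v))

    from-1 : ∀ (b : ℕ → ℤ) → ∑< (suc n) (λ j → ι (does (i <? j)) (b j)) ≡
                             ∑< n (λ j → ι (does (i <? suc j)) (b (suc j)))
    from-1 b = trans (∑<-suc n (λ j → ι (does (i <? j)) (b j))) (ℤ.+-identityˡ _)

    middle : f (basis (suc n) i) ≡ G n
    middle = sym (trans (ι-yes (inRow? i n) (i≤n , ℕ.+-monoʳ-≤ n i≤n)) (cong f (root-n i)))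

    short≡ : ∀ v → v < n → short (suc v) ≡ G v
    short≡ v v<n = ι-⇔ (i <? suc v) (inRow? i v)
      (λ i<1+v → ℕ.s≤s⁻¹ i<1+v , ℕ.+-mono-≤ (ℕ.<⇒≤ v<n) i≤n) (λ (i≤v , _) → s≤s i≤v)
      (cong f (sym (root-< i v<n)))

    long≡ : ∑< n (long ∘ suc) ≡ ∑< n (λ w → G (suc n + w))
    long≡ = trans (∑<-cong n term≡) (sym (∑<-reverse n (λ w → G (suc n + w))))
      where
      term≡ : ∀ v → v < n → long (suc v) ≡ G (suc n + (n ∸ suc v))
      term≡ v v<n = ι-⇔ (i <? suc v) (inRow? i V) to from (cong f (sym root≡))
        where
        V : ℕ
        -- This is 2n - v in a form without truncation, the column of e_i + e_{v+1} (0-based).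
        V = suc n + (n ∸ suc v)
        V+v : V + v ≡ n + n
        V+v = begin
          suc n + (n ∸ suc v) + v   ≡⟨ lemma n (n ∸ suc v) v ⟩
          n + (suc v + (n ∸ suc v)) ≡⟨ cong (_+_ n) (ℕ.m+[n∸m]≡n v<n) ⟩
          n + n                     ∎
          where
          lemma : ∀ a b c → suc a + b + c ≡ a + (suc c + b)
          lemma = ℕ-Ring.solve-∀
        n<V : n < V
        n<V = ℕ.m≤m+n (suc n) (n ∸ suc v)
        to : i < suc v → InRow i V
        to i<1+v = ℕ.≤-trans i≤n (ℕ.<⇒≤ n<V) ,
                   subst (V + i ≤_) V+v (ℕ.+-monoʳ-≤ V (ℕ.s≤s⁻¹ i<1+v))
        from : InRow i V → i < suc v
        from (_ , V+i≤2n) = s≤s (ℕ.+-cancelˡ-≤ V i v (subst (V + i ≤_) (sym V+v) V+i≤2n))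
        root≡ : root i V ≡ basis (suc n) i +ᵛ basis (suc n) (suc v)
        root≡ = trans (root-≥ i (ℕ.<⇒≤ n<V)) (cong (λ j → basis (suc n) i +ᵛ basis (suc n) j) (begin
          suc (n + n) ∸ V     ≡⟨ cong (λ x → suc x ∸ V) V+v ⟨
          suc (V + v) ∸ V     ≡⟨ cong (_∸ V) (ℕ.+-suc V v) ⟨
          V + suc v ∸ V       ≡⟨ ℕ.m+n∸m≡n V (suc v) ⟩
          suc v               ∎))

  pairs : List (Fin (suc n) × Fin (suc n))
  pairs = List.filter (λ (i , j) → i Fin.<? j) (List.cartesianProduct (List.allFin (suc n)) (List.allFin (suc n)))

  ∑-pairs : ∀ (_∙_ : Vec ℤ (suc n) → Vec ℤ (suc n) → Vec ℤ (suc n)) f →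
    ∑ᴸ (List.map (λ (i , j) → e i ∙ e j) pairs) f ≡
    ∑< (suc n) (λ i → ∑< (suc n) (λ j → ι (does (i <? j)) (f (basis (suc n) i ∙ basis (suc n) j))))
  ∑-pairs _∙_ f = begin
    ∑ᴸ (List.map g pairs) f
      ≡⟨ ∑ᴸ-map g pairs f ⟩
    ∑ᴸ pairs (f ∘ g)
      ≡⟨ ∑ᴸ-filter (λ (i , j) → i Fin.<? j) (List.cartesianProduct (List.allFin (suc n)) (List.allFin (suc n))) (f ∘ g) ⟩
    ∑ᴸ (List.cartesianProduct (List.allFin (suc n)) (List.allFin (suc n))) (λ (i , j) → ι (does (i Fin.<? j)) (f (e i ∙ e j)))
      ≡⟨ ∑ᴸ-product _,_ (List.allFin (suc n)) (List.allFin (suc n))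
           (λ (i , j) → ι (does (i Fin.<? j)) (f (e i ∙ e j))) ⟩
    ∑ᴸ (List.allFin (suc n)) (λ i → ∑ᴸ (List.allFin (suc n)) (λ j → ι (does (i Fin.<? j)) (f (e i ∙ e j))))
      ≡⟨ ∑ᴸ-tabulate id _ (λ i → ∑ᴸ-tabulate id _ (λ j →
           cong₂ (λ v w → ι (does (i Fin.<? j)) (f (v ∙ w))) (e≡basis i) (e≡basis j))) ⟩
    ∑< (suc n) (λ i → ∑< (suc n) (λ j → ι (does (i <? j)) (f (basis (suc n) i ∙ basis (suc n) j)))) ∎
    where
    open ≡-Reasoning
    g : Fin (suc n) × Fin (suc n) → Vec ℤ (suc n)
    g (i , j) = e i ∙ e j

  -- Holds for every summand `f`, so the chain recursions can be compared without a bijection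
  -- between lists.
  ∑-positiveRoots : ∀ f → ∑ᴸ (positiveRoots (suc n)) f ≡
    ∑< (suc n) λ u → ∑< (suc (n + n)) λ v → ι (does (valid? u v)) (f (root (n ∸ u) v))
  ∑-positiveRoots f = begin
    ∑ᴸ (positiveRoots (suc n)) f
      ≡⟨ trans (∑ᴸ-++ (List.map (λ (i , j) → e i -ᵛ e j) pairs) _ f)
               (cong (ℤ._+_ (∑ᴸ (List.map (λ (i , j) → e i -ᵛ e j) pairs) f)) (∑ᴸ-++ (List.map e (List.allFin (suc n))) _ f)) ⟩
    ∑ᴸ (List.map (λ (i , j) → e i -ᵛ e j) pairs) f ℤ.+
    (∑ᴸ (List.map e (List.allFin (suc n))) f ℤ.+ ∑ᴸ (List.map (λ (i , j) → e i +ᵛ e j) pairs) f)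
      ≡⟨ cong₂ ℤ._+_ (∑-pairs _-ᵛ_ f) (cong₂ ℤ._+_ ∑-e (∑-pairs _+ᵛ_ f)) ⟩
    ∑< (suc n) short ℤ.+ (∑< (suc n) (f ∘ basis (suc n)) ℤ.+ ∑< (suc n) long)
      ≡⟨ cong (ℤ._+_ (∑< (suc n) short)) (∑<-+ (suc n) (f ∘ basis (suc n)) long) ⟨
    ∑< (suc n) short ℤ.+ ∑< (suc n) (λ i → f (basis (suc n) i) ℤ.+ long i)
      ≡⟨ ∑<-+ (suc n) short _ ⟨
    ∑< (suc n) (λ i → short i ℤ.+ (f (basis (suc n) i) ℤ.+ long i))
      ≡⟨ ∑<-cong (suc n) (λ i i<r → row-split f i (ℕ.s≤s⁻¹ i<r)) ⟩
    ∑< (suc n) (row f)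
      ≡⟨ ∑<-reverse (suc n) (row f) ⟩
    ∑< (suc n) (λ u → row f (n ∸ u))
      ≡⟨ ∑<-cong (suc n) (λ u u<r → ∑<-cong (suc (n + n)) (λ v _ →
           ι-⇔ (inRow? (n ∸ u) v) (valid? u v) InRow⇒Valid (Valid⇒InRow (ℕ.s≤s⁻¹ u<r)) refl)) ⟩
    (∑< (suc n) λ u → ∑< (suc (n + n)) λ v → ι (does (valid? u v)) (f (root (n ∸ u) v))) ∎
    where
    open ≡-Reasoning
    short long : ℕ → ℤ
    short i = ∑< (suc n) (λ j → ι (does (i <? j)) (f (basis (suc n) i -ᵛ basis (suc n) j)))
    long  i = ∑< (suc n) (λ j → ι (does (i <? j)) (f (basis (suc n) i +ᵛ basis (suc n) j)))
    ∑-e : ∑ᴸ (List.map e (List.allFin (suc n))) f ≡ ∑< (suc n) (f ∘ basis (suc n))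
    ∑-e = trans (∑ᴸ-map e (List.allFin (suc n)) f)
                (∑ᴸ-tabulate id (f ∘ basis (suc n)) (cong f ∘ e≡basis))

  -- Bounding the maximal rank needs each listed root in the form `root i v`, which an identity of
  -- sums does not supply.
  All-positiveRoots : ∀ {Q : Vec ℤ (suc n) → Set} → (∀ {i v} → i ≤ n → InRow i v → Q (root i v)) →
                      All Q (positiveRoots (suc n))
  All-positiveRoots {Q} q =
    All.++⁺ (All.map⁺ {f = λ (i , j) → e i -ᵛ e j} (All.map (λ {ij} → difference ij) increasing))
    (All.++⁺ (All.map⁺ {f = e} (All.tabulate {xs = List.allFin (suc n)} λ {i} _ → single i))
             (All.map⁺ {f = λ (i , j) → e i +ᵛ e j} (All.map (λ {ij} → total ij) increasing)))
    where
    increasing : All (λ ij → proj₁ ij Fin.< proj₂ ij) pairs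
    increasing = All.all-filter (λ (i , j) → i Fin.<? j) (List.cartesianProduct (List.allFin (suc n)) (List.allFin (suc n)))

    single : ∀ i → Q (e i)
    single i = subst Q (trans (root-n (toℕ i)) (sym (e≡basis i)))
                 (q i≤n (i≤n , ℕ.+-monoʳ-≤ n i≤n))
      where
      i≤n : toℕ i ≤ n
      i≤n = ℕ.s≤s⁻¹ (Fin.toℕ<n i)

    difference : ∀ (ij : Fin (suc n) × Fin (suc n)) → proj₁ ij Fin.< proj₂ ij → Q (e (proj₁ ij) -ᵛ e (proj₂ ij))
    difference (i , Fin.suc j) (s≤s i≤j) =
      subst Q (trans (root-< (toℕ i) (Fin.toℕ<n j)) (sym (cong₂ _-ᵛ_ (e≡basis i) (e≡basis (Fin.suc j)))))
        (q i≤n (i≤j , ℕ.+-mono-≤ (ℕ.<⇒≤ (Fin.toℕ<n j)) i≤n))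
      where
      i≤n : toℕ i ≤ n
      i≤n = ℕ.s≤s⁻¹ (Fin.toℕ<n i)

    total : ∀ (ij : Fin (suc n) × Fin (suc n)) → proj₁ ij Fin.< proj₂ ij → Q (e (proj₁ ij) +ᵛ e (proj₂ ij))
    total (i , j) i<j =
      subst Q (trans (root-≥ (toℕ i) n≤V) (trans (cong (λ k → basis (suc n) (toℕ i) +ᵛ basis (suc n) k) (ℕ.m∸[m∸n]≡n j≤))
                (sym (cong₂ _+ᵛ_ (e≡basis i) (e≡basis j)))))
        (q i≤n (ℕ.≤-trans i≤n n≤V , ℕ.s≤s⁻¹ V+i<))
      where
      open ℕ.≤-Reasoning
      i≤n : toℕ i ≤ n
      i≤n = ℕ.s≤s⁻¹ (Fin.toℕ<n i)
      j≤ : toℕ j ≤ suc (n + n)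
      j≤ = ℕ.≤-trans (ℕ.<⇒≤ (Fin.toℕ<n j)) (s≤s (ℕ.m≤m+n n n))
      V+i< : suc (n + n) ∸ toℕ j + toℕ i < suc (n + n)
      V+i< = begin-strict
        suc (n + n) ∸ toℕ j + toℕ i   <⟨ ℕ.+-monoʳ-< (suc (n + n) ∸ toℕ j) i<j ⟩
        suc (n + n) ∸ toℕ j + toℕ j   ≡⟨ ℕ.m∸n+n≡m j≤ ⟩
        suc (n + n)                   ∎
      n≤V : n ≤ suc (n + n) ∸ toℕ j
      n≤V = ℕ.m+n≤o⇒m≤o∸n n (ℕ.≤-trans (ℕ.+-monoʳ-≤ n (ℕ.<⇒≤ (Fin.toℕ<n j))) (ℕ.≤-reflexive (ℕ.+-suc n n)))

  maxRank≡2n : maxRank ≡ n + n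
  maxRank≡2n = ℕ.≤-antisym
    (max≤v⁺ z≤n (All.map⁺ (All-positiveRoots λ {i} {v} i≤n iv@(_ , v+i≤2n) →
      ℕ.≤-trans (ℕ.≤-reflexive (rk-root i≤n iv))
                (ℕ.≤-trans (ℕ.m∸n≤m v i) (ℕ.m+n≤o⇒m≤o v v+i≤2n)))))
    (2n≤ n refl)
    where
    -- The highest root, the sum of the first two basis vectors, exists only for `n ≥ 1`; at `n = 0`
    -- the bound is trivial.
    2n≤ : ∀ m → m ≡ n → n + n ≤ maxRank
    2n≤ zero    refl = z≤n
    2n≤ (suc m) refl =
      v≤max⁺ 0 (List.map rk (positiveRoots (suc n))) (inj₂ (Any.map⁺ (lose highest∈ (ℕ.≤-reflexive (sym rk≡2n)))))
      where
      open ≡-Reasoning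
      highest : Vec ℤ (suc n)
      highest = e Fin.zero +ᵛ e (Fin.suc Fin.zero)
      highest∈ : highest ∈ positiveRoots (suc n)
      highest∈ = ∈-++⁺ʳ (List.map (λ (i , j) → e i -ᵛ e j) pairs) (∈-++⁺ʳ (List.map e (List.allFin (suc n)))
        (∈-map⁺ (λ (i , j) → e i +ᵛ e j) (∈-filter⁺ (λ (i , j) → i Fin.<? j)
          (∈-cartesianProduct⁺ (∈-allFin Fin.zero) (∈-allFin (Fin.suc Fin.zero))) (s≤s z≤n))))
      rk≡2n : rk highest ≡ n + n
      rk≡2n = begin
        rk highest              ≡⟨ cong (λ j → rk (e Fin.zero +ᵛ basis (suc n) j)) (ℕ.m+n∸n≡m 1 (n + n)) ⟨
        rk (basis (suc n) 0 +ᵛ basis (suc n) (suc (n + n) ∸ (n + n)))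
                                ≡⟨ cong rk (root-≥ 0 (ℕ.m≤m+n n n)) ⟨
        rk (root 0 (n + n))     ≡⟨ rk-root z≤n (z≤n , ℕ.≤-reflexive (ℕ.+-identityʳ (n + n))) ⟩
        n + n                   ∎

  root≼? : ∀ {u v u′ v′} → u ≤ n → u′ ≤ n → Valid u v → Valid u′ v′ →
           does (root (n ∸ u) v ≼? root (n ∸ u′) v′) ≡ does (u <? suc u′ ×-dec v <? suc v′)
  root≼? {u} {v} {u′} {v′} u≤n u′≤n uv uv′ = does-⇔ (mk⇔ to from) (_ ≼? _) (u <? suc u′ ×-dec v <? suc v′)
    where
    α β : Vec ℤ (suc n)
    α = root (n ∸ u) v
    β = root (n ∸ u′) v′
    to : α ≼ β → u < suc u′ × v < suc v′
    to α≼β =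
      s≤s (subst₂ _≤_ (ℕ.m∸[m∸n]≡n u≤n) (ℕ.m∸[m∸n]≡n u′≤n) (ℕ.∸-monoʳ-≤ n
        (partialSum≤⇒i≥ (ℕ.m∸n≤m n u) (Valid⇒InRow u≤n uv) (Valid⇒InRow u′≤n uv′) α≤β))) ,
      s≤s (partialSum≤⇒v≤ (ℕ.m∸n≤m n u) (Valid⇒InRow u≤n uv) α≤β)
      where
      α≤β : ∀ p → p < suc n → partialSum α p ℤ.≤ partialSum β p
      α≤β = proj₁ (≼⇔partialSum≤ α β) α≼β
    from : u < suc u′ × v < suc v′ → α ≼ β
    from (s≤s u≤u′ , s≤s v≤v′) = proj₂ (≼⇔partialSum≤ α β) λ p p<r →
      partialSum-mono p (ℕ.s≤s⁻¹ p<r) (ℕ.∸-monoʳ-≤ n u≤u′) v≤v′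

  rk-root-uv : ∀ {u v} → u ≤ n → Valid u v → rk (root (n ∸ u) v) ≡ u + v ∸ n
  rk-root-uv {u} {v} u≤n uv@(n≤u+v , _) = begin
    rk (root (n ∸ u) v)       ≡⟨ rk-root (ℕ.m∸n≤m n u) (Valid⇒InRow u≤n uv) ⟩
    v ∸ (n ∸ u)               ≡⟨ ℕ.[m+n]∸[m+o]≡n∸o u v (n ∸ u) ⟨
    (u + v) ∸ (u + (n ∸ u))   ≡⟨ cong (u + v ∸_) (ℕ.m+[n∸m]≡n u≤n) ⟩
    u + v ∸ n                 ∎
    where open ≡-Reasoning

  -- The ideal of a root is the valid part of the rectangle under its grid point, so both recursions
  -- run over the same tops.
  B≡R : ∀ m {u v} → u ≤ n → Valid u v → B m (root (n ∸ u) v) ≗ R (suc u) (suc v) m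
  B≡R zero    u≤n uv d = refl
  B≡R (suc m) {u′} {v′} u′≤n uv′@(_ , v′≤n+u′) d = begin
    B (suc m) β d
      ≡⟨ ∑-positiveRoots (λ y → ι (does (y ≼? β)) (sh (rk y) (B m y) d)) ⟩
    (∑< (suc n) λ u → ∑< (suc (n + n)) λ v →
      ι (does (valid? u v)) (ι (does (root (n ∸ u) v ≼? β)) (sh (rk (root (n ∸ u) v)) (B m (root (n ∸ u) v)) d)))
      ≡⟨ ∑<-cong (suc n) (λ u u<r → ∑<-cong (suc (n + n)) (λ v _ → term≡ u v (ℕ.s≤s⁻¹ u<r))) ⟩
    (∑< (suc n) λ u → ∑< (suc (n + n)) λ v → ι (does (u <? suc u′)) (ι (does (v <? suc v′)) (cell u v)))
      -- The order condition cuts the full ranges down to the rectangle, which fits inside them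
      -- because `v′ ≤ n + u′ ≤ n + n`.
      ≡⟨ ∑<-cong (suc n) (λ u _ → trans
           (∑<-ι (suc (n + n)) (does (u <? suc u′)) (λ v → ι (does (v <? suc v′)) (cell u v)))
           (cong (ι (does (u <? suc u′)))
             (∑<-truncate (s≤s (ℕ.≤-trans v′≤n+u′ (ℕ.+-monoʳ-≤ n u′≤n))) (cell u)))) ⟩
    (∑< (suc n) λ u → ι (does (u <? suc u′)) (∑< (suc v′) (cell u)))
      ≡⟨ ∑<-truncate (s≤s u′≤n) (λ u → ∑< (suc v′) (cell u)) ⟩
    R (suc u′) (suc v′) (suc m) d ∎
    where
    open ≡-Reasoning
    β : Vec ℤ (suc n)
    β = root (n ∸ u′) v′
    cell : ℕ → ℕ → ℤ
    cell u v = ι (does (valid? u v)) (sh (u + v ∸ n) (R (suc u) (suc v) m) d)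
    term≡ : ∀ u v → u ≤ n →
      ι (does (valid? u v)) (ι (does (root (n ∸ u) v ≼? β)) (sh (rk (root (n ∸ u) v)) (B m (root (n ∸ u) v)) d)) ≡
      ι (does (u <? suc u′)) (ι (does (v <? suc v′)) (cell u v))
    term≡ u v u≤n = trans
      (ι-cong (valid? u v) λ uv → cong₂ ι (root≼? u≤n u′≤n uv uv′)
        (trans (cong (λ a → sh a (B m (root (n ∸ u) v)) d) (rk-root-uv u≤n uv))
               (sh-cong (u + v ∸ n) (B≡R m u≤n uv) d)))
      (ι-× (u <? suc u′) (v <? suc v′) (does (valid? u v)) (sh (u + v ∸ n) (R (suc u) (suc v) m) d))

  A≐R : ⟦ A ⟧ ≐ R (suc n) (suc (n + n))
  A≐R zero    d = coeff-A-0 d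
  A≐R (suc m) d = begin
    coeff (A (suc m)) d
      ≡⟨ coeff-A-suc m d ⟩
    ∑ᴸ (positiveRoots (suc n)) (λ y → sh (rk y) (B m y) d)
      ≡⟨ ∑-positiveRoots (λ y → sh (rk y) (B m y) d) ⟩
    (∑< (suc n) λ u → ∑< (suc (n + n)) λ v →
      ι (does (valid? u v)) (sh (rk (root (n ∸ u) v)) (B m (root (n ∸ u) v)) d))
      ≡⟨ ∑<-cong (suc n) (λ u u<r → ∑<-cong (suc (n + n)) (λ v _ → ι-cong (valid? u v) λ uv →
           trans (cong (λ a → sh a (B m (root (n ∸ u) v)) d) (rk-root-uv (ℕ.s≤s⁻¹ u<r) uv))
                 (sh-cong (u + v ∸ n) (B≡R m (ℕ.s≤s⁻¹ u<r) uv) d))) ⟩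
    R (suc n) (suc (n + n)) (suc m) d ∎
    where open ≡-Reasoning

  -- The highest root lies on the diagonal and adds nothing to the numerator of its unique lower
  -- cover. This saves one unit: length `2n` gives `s = 2(n-k)` and the sharp degree, and the index
  -- 1 is off the diagonal as `N-top` requires.
  ℍ-B≐N : ⟦ ℍ-B (suc n) ⟧ ≐ N 1 (n + n)
  ℍ-B≐N m d = begin
    coeff (ℍ-B (suc n) m) d
      ≡⟨ ⟦∏⊛⟧ (List.upTo (suc maxRank)) A m d ⟩
    List.foldr T ⟦ A ⟧ (List.upTo (suc maxRank)) m d
      ≡⟨ cong (λ F → F m d) (foldr-T-upTo (suc maxRank) ⟦ A ⟧) ⟩
    Tⁿ (suc maxRank) ⟦ A ⟧ m d
      ≡⟨ cong (λ H → Tⁿ (suc H) ⟦ A ⟧ m d) maxRank≡2n ⟩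
    Tⁿ (suc (n + n)) ⟦ A ⟧ m d
      ≡⟨ Tⁿ-cong (suc (n + n)) A≐R m d ⟩
    Tⁿ (suc (n + n)) (R (suc n) (suc (n + n))) m d
      ≡⟨ Tⁿ-R≐N (suc (n + n)) 0 (suc n) (suc (n + n))
           (trans (ℕ.+-identityʳ _) (sym (ℕ.+-suc n n))) refl ℕ.≤-refl m d ⟩
    N 1 (n + n) m d ℤ.+ 0ℤ
      ≡⟨ ℤ.+-identityʳ _ ⟩
    N 1 (n + n) m d ∎
    where open ≡-Reasoning

-- Shape of the numerator and the closed degree formula

numerator-shape : ∀ k s {p} → coeff p ≗ N 1 (2 * k + s) k →
  let d = k * (k ∸ 1) + k * s in
  (p ∈q^ (k * (k ∸ 1)) ℕ[q]) × HasDegree p d × (coeff p d ≡ 1ℤ)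
numerator-shape k s {p} p≗N = Good⇒∈q^ℕ[q] {k} {s} {p} good , (nonzero , Good⇒deg≤ {k} {s} good) , top
  where
  good : Good k (2 * k + s) (coeff p)
  good d with Good-N 1 (2 * k + s) k d
  ... | a , N≡ , supported = a , trans (p≗N d) N≡ , supported
  top : coeff p (k * (k ∸ 1) + k * s) ≡ 1ℤ
  top = trans (p≗N _) (N-top k s 0 (2 * k + s) refl)
  nonzero : coeff p (k * (k ∸ 1) + k * s) ≢ 0ℤ
  nonzero ≡0 with trans (sym top) ≡0
  ... | ()

-- With `m = n - k` the subtractions are exact for `k ≥ 1`; at `k = 0` any truncation is hidden by
-- the factor `k`.
degree-formula : ∀ k m → k * (k ∸ 1) + k * (m + m) ≡ k * (2 * (k + m) ∸ k ∸ 1)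
degree-formula zero    m = refl
degree-formula (suc k) m = begin
  suc k * k + suc k * (m + m)                    ≡⟨ ℕ.*-distribˡ-+ (suc k) k (m + m) ⟨
  suc k * (k + (m + m))                          ≡⟨ cong (suc k *_) (ℕ.m+n∸m≡n (suc k + 1) (k + (m + m))) ⟨
  suc k * (suc k + 1 + (k + (m + m)) ∸ (suc k + 1)) ≡⟨ cong (suc k *_) (ℕ.∸-+-assoc (suc k + 1 + (k + (m + m))) (suc k) 1) ⟨
  suc k * (suc k + 1 + (k + (m + m)) ∸ suc k ∸ 1) ≡⟨ cong (λ x → suc k * (x ∸ suc k ∸ 1)) (lemma k m) ⟩
  suc k * (2 * (suc k + m) ∸ suc k ∸ 1)          ∎
  where
  open ≡-Reasoning
  lemma : ∀ k m → suc k + 1 + (k + (m + m)) ≡ 2 * (suc k + m)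
  lemma = ℕ-Ring.solve-∀

corollary8p6 :
    (r : ℕ) → r ≥ 1 →
    let n = r ∸ 1 in
    (k : ℕ) → k ≤ n →
    let h = ℍ-B r k
        d = k * (2 * n ∸ k ∸ 1)
    in (h ∈q^ (k * (k ∸ 1)) ℕ[q]) × HasDegree h d × (coeff h d ≡ 1ℤ)
corollary8p6 (suc n) (s≤s z≤n) k k≤n =
  subst (λ d → (h ∈q^ (k * (k ∸ 1)) ℕ[q]) × HasDegree h d × (coeff h d ≡ 1ℤ)) degree≡
    (numerator-shape k (m + m) {h} λ d →
      trans (Numerator.ℍ-B≐N n k d) (cong (λ L → N 1 L k d) size≡))
  where
  h : Poly
  h = ℍ-B (suc n) k
  m : ℕ
  m = n ∸ k
  size≡ : n + n ≡ 2 * k + (m + m)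
  size≡ = trans (cong (λ x → x + x) (sym (ℕ.m+[n∸m]≡n k≤n))) (lemma k m)
    where
    lemma : ∀ k m → k + m + (k + m) ≡ 2 * k + (m + m)
    lemma = ℕ-Ring.solve-∀
  degree≡ : k * (k ∸ 1) + k * (m + m) ≡ k * (2 * n ∸ k ∸ 1)
  degree≡ = trans (degree-formula k m) (cong (λ x → k * (2 * x ∸ k ∸ 1)) (ℕ.m+[n∸m]≡n k≤n))
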